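{- Let $r\leqslant 1$ be an odd integer coprime with $5$. Let $p$ be a prime such that $p\equiv -\frac{r}{2}\pmod{5}$ (i.e. $2p\equiv -r \pmod 5$) and $p\geqslant \frac{5-r}{2}$. Then $$\sum_{k=0}^{p-1}(10k+r)\frac{\left(\frac{r}{5}\right)_k^5}{k!^5}\equiv 0 \pmod{p^4}.$$
   Context: For a complex (here rational) number $a$ and a non-negative integer $k$, $(a)_k=a(a+1)\cdots(a+k-1)$ denotes the Pochhammer symbol, with $(a)_0=1$. The sum is a rational number whose denominator is not divisible by $p$; a congruence modulo $p^m$ between such rational numbers means their difference is $p^m$ times a rational number with denominator coprime to $p$ (equivalently, congruence in $\mathbb{Z}_p$). -}

module Defs where

open import Data.Integer.Base as ℤ using (ℤ; +_)
open import Data.Nat.Base as ℕ using (ℕ; zero; suc; NonZero; _!)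
open import Data.Nat.Coprimality using (Coprime)
open import Data.Nat.Properties using (_!≢0; m^n≢0)
open import Data.Product.Base using (∃-syntax; _×_)
open import Data.Rational.Base using (ℚ; 1ℚ; ↧ₙ_; _/_; _+_; _-_; _*_; +-*-rawSemiring)
open import Relation.Binary.PropositionalEquality.Core using (_≡_)

open import Algebra.Definitions.RawSemiring +-*-rawSemiring public using (_^_)

fromℤ : ℤ → ℚ
fromℤ i = i / 1

fromℕ : ℕ → ℚ
fromℕ n = fromℤ (+ n)

pochhammer : ℚ → ℕ → ℚ
pochhammer a zero    = 1ℚ
pochhammer a (suc k) = pochhammer a k * (a + fromℕ k)

-- _/_ on ℚ divides an integer by a natural number, so the division by k!⁵
-- is multiplication by the fraction 1 / k!⁵.
summand : ℤ → ℕ → ℚ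
summand r k =
  fromℤ (+ 10 ℤ.* + k ℤ.+ r) * pochhammer (r / 5) k ^ 5 * (+ 1 / ((k !) ℕ.^ 5))
  where
  instance
    k!^5≢0 : NonZero ((k !) ℕ.^ 5)
    k!^5≢0 = m^n≢0 (k !) 5 {{k !≢0}}

-- Both sides may be arbitrary rationals; only the quotient q of their
-- difference by p ^ m is required to have denominator coprime to p.
infix 4 _≡_[mod_^_]
_≡_[mod_^_] : ℚ → ℚ → ℕ → ℕ → Set
a ≡ b [mod p ^ m ] =
  ∃[ q ] Coprime (↧ₙ q) p × a - b ≡ fromℕ (p ℕ.^ m) * q

{-# OPTIONS --safe #-}

-- The case p = 2 forces r = 1 and is a computation.  For odd p, put h = p/5,
-- a = r/5, m = (2p + r)/5 = 2t + 1 and N = p − m, so that a = m − 2h and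
-- a + N = 3h.  With f x k = ∏_{j<k} (a + x + j)/(1 − x + j), the summand is
-- 5 (2k + a) (f 0 k)⁵, and it is divisible by p⁵ for N < k < p.
--
-- If x₁ + x₂ + x₃ + x₄ = 0 and p divides every xᵢ, then
--   ∏ f xᵢ k ≡ (f 0 k)⁴ (1 + e₂ A k + e₃ B k)  (mod p⁴)
-- with e₂, e₃ the elementary symmetric functions of the xᵢ.  For the shifts
-- (−3h, h, h, h) and (−3h, h, 0, 2h) the sums ∑ (2k + a) f 0 k ∏ f xᵢ k over k ≤ N
-- vanish exactly: (2k + a) f 0 k f (−3h) k is the divided difference weight at the
-- nodes k (k + a), k ≤ N, and the other factors form a polynomial of degree
-- 3t < N in the node.  Since e₂ is −6h², −7h² and e₃ is −8h³, −6h³, seven times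
-- the first sum minus six times the second eliminates A and leaves
--   ∑ (2k + a) (f 0 k)⁵ ≡ 20 h³ ∑ (2k + a) (f 0 k)⁵ B k  (mod p⁴),
-- and the sum on the right is antisymmetric modulo p under k ↦ N − k.
module Submission where

open import Defs
open import Data.Fin.Base using (toℕ)
open import Data.Integer.Base as ℤ using (ℤ; +_; 1ℤ)
open import Data.Integer.Coprimality using (Coprime)
open import Data.Integer.Divisibility using (_∣_)
open import Data.Nat.Base using (ℕ)
open import Data.Nat.Primality using (Prime)
open import Data.Rational.Base using (0ℚ; _/_; _≥_)
open import Data.Rational.Properties using (+-0-monoid)
open import Algebra.Properties.Monoid.Sum +-0-monoid using (sum-syntax)
open import Relation.Nullary.Negation.Core using (¬_)
open import Data.Integer.Base using (-[1+_])
import Data.Integer.Divisibility.Signed as Signed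
import Data.Integer.Properties as ℤ
import Data.Integer.Tactic.RingSolver as ℤ-Solver
open import Data.Maybe.Base using (Maybe)
open import Data.Nat.Base as ℕ using (zero; suc; s≤s; z≤n; _!)
import Data.Nat.Coprimality as ℕ using (Coprime; coprime?; coprime-divisor; recompute) renaming (sym to coprime-sym)
import Data.Nat.Divisibility as ℕ
open import Data.Nat.Primality using (euclidsLemma; irreducible?; prime?; prime⇒irreducible; prime⇒nonTrivial)
import Data.Nat.Properties as ℕ
import Data.Nat.Tactic.RingSolver as ℕ-Solver
open import Data.Product.Base using (_,_; ∃-syntax)
open import Data.Rational.Base using (ℚ; mkℚ; 1ℚ; 1/_; _+_; _-_; -_; _*_; ↧ₙ_; toℚᵘ; ≢-nonZero)
open import Data.Rational.Properties
import Data.Rational.Unnormalised.Base as ℚᵘ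
import Data.Rational.Unnormalised.Properties as ℚᵘ
open import Data.Sum.Base using (_⊎_; inj₁; inj₂; [_,_]′)
open import Relation.Binary.PropositionalEquality
open import Relation.Nullary using (yes; no; contradiction)
open import Relation.Nullary.Decidable using (dec⇒maybe; from-no; from-yes)
open import Tactic.RingSolver using (solve-∀)
open import Tactic.RingSolver.Core.AlmostCommutativeRing using (AlmostCommutativeRing; fromCommutativeRing)

-- The shift -3h equals -(a + N), so its factor carries (-N)_k and supplies both the end of the sum
-- and the weight. The other three shifts must add up to 3h and give a polynomial in k (k + a). In f
-- x · f (2h - x) the numerator of each quotient starts 2t above the denominator of the other, so
-- the product is a polynomial in k; its linear factors pair up under k ↦ -a - k, which makes it a
-- polynomial of degree 2t in the node. The shift h is its own partner and alone gives degree t.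
-- Thus (-3h, h, x, 2h - x) works for every x, and with w = x (2h - x) it has e₂ = w - 7h² and e₃ =
-- -2hw - 6h³. The two quadruples are w = h² and w = 0, and the coefficients 7 and -6 extrapolate to
-- w = 7h², where e₂ = 0 and e₃ = -20h³. This elimination of A is the crux. Reflection k ↦ N - k
-- controls the sums with A and B only modulo p: enough beside e₃, which already brings p³, but one
-- power short beside e₂. Vanishing e₁ removes the first order, and products of two correction terms
-- lie in p⁴. The fifth factor f 0 k is carried along exactly.

isZero? : ∀ x → Maybe (0ℚ ≡ x)
isZero? x = dec⇒maybe (0ℚ ≟ x)

ring : AlmostCommutativeRing _ _
ring = fromCommutativeRing +-*-commutativeRing isZero?

-- Embedding ℤ into ℚ

toℚᵘ-fromℤ : ∀ i → toℚᵘ (fromℤ i) ℚᵘ.≃ ℚᵘ.mkℚᵘ i 0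
toℚᵘ-fromℤ i = toℚᵘ-fromℚᵘ (ℚᵘ.mkℚᵘ i 0)

fromℤ-+ : ∀ i j → fromℤ (i ℤ.+ j) ≡ fromℤ i + fromℤ j
fromℤ-+ i j = toℚᵘ-injective (ℚᵘ.≃-trans (toℚᵘ-fromℤ (i ℤ.+ j)) (ℚᵘ.≃-sym (ℚᵘ.≃-trans (toℚᵘ-homo-+ (fromℤ i) (fromℤ j))
  (ℚᵘ.≃-trans (ℚᵘ.+-cong (toℚᵘ-fromℤ i) (toℚᵘ-fromℤ j)) (ℚᵘ.*≡* (identity i j))))))
  where
  identity : ∀ i j → (i ℤ.* + 1 ℤ.+ j ℤ.* + 1) ℤ.* + 1 ≡ (i ℤ.+ j) ℤ.* + 1
  identity = ℤ-Solver.solve-∀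

fromℤ-* : ∀ i j → fromℤ (i ℤ.* j) ≡ fromℤ i * fromℤ j
fromℤ-* i j = toℚᵘ-injective (ℚᵘ.≃-trans (toℚᵘ-fromℤ (i ℤ.* j)) (ℚᵘ.≃-sym (ℚᵘ.≃-trans (toℚᵘ-homo-* (fromℤ i) (fromℤ j))
  (ℚᵘ.*-cong (toℚᵘ-fromℤ i) (toℚᵘ-fromℤ j)))))

fromℤ-injective : ∀ {i j} → fromℤ i ≡ fromℤ j → i ≡ j
fromℤ-injective {i} {j} eq with ℚᵘ.≃-trans (ℚᵘ.≃-sym (toℚᵘ-fromℤ i)) (ℚᵘ.≃-trans (ℚᵘ.≃-reflexive (cong toℚᵘ eq)) (toℚᵘ-fromℤ j))
... | ℚᵘ.*≡* e = trans (sym (ℤ.*-identityʳ i)) (trans e (ℤ.*-identityʳ j))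

i/n*n : ∀ i n .{{_ : ℕ.NonZero n}} → (i / n) * fromℕ n ≡ fromℤ i
i/n*n i (suc n) = toℚᵘ-injective (ℚᵘ.≃-trans (toℚᵘ-homo-* (i / suc n) (fromℕ (suc n)))
  (ℚᵘ.≃-trans (ℚᵘ.*-cong (toℚᵘ-fromℚᵘ (ℚᵘ.mkℚᵘ i n)) (toℚᵘ-fromℤ (+ suc n))) (ℚᵘ.≃-trans (ℚᵘ.*≡* identity) (ℚᵘ.≃-sym (toℚᵘ-fromℤ i)))))
  where
  identity : (i ℤ.* + suc n) ℤ.* + 1 ≡ i ℤ.* (+ suc n ℤ.* + 1)
  identity = ℤ.*-assoc i (+ suc n) (+ 1)

fromℕ-suc : ∀ n → fromℕ (suc n) ≡ 1ℚ + fromℕ n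
fromℕ-suc n = fromℤ-+ (+ 1) (+ n)

fromℤ-neg : ∀ i → fromℤ (ℤ.- i) ≡ - fromℤ i
fromℤ-neg i = begin
  fromℤ (ℤ.- i)                            ≡⟨ identity (fromℤ (ℤ.- i)) (fromℤ i) ⟩
  fromℤ (ℤ.- i) + fromℤ i - fromℤ i        ≡⟨ cong (_- fromℤ i) (fromℤ-+ (ℤ.- i) i) ⟨
  fromℤ (ℤ.- i ℤ.+ i) - fromℤ i            ≡⟨ cong (λ j → fromℤ j - fromℤ i) (ℤ.+-inverseˡ i) ⟩
  0ℚ - fromℤ i                             ≡⟨ +-identityˡ (- fromℤ i) ⟩
  - fromℤ i                                ∎
  where
  open ≡-Reasoning
  identity : ∀ x y → x ≡ x + y - y
  identity = solve-∀ ring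

1+n≢0 : ∀ n → fromℕ (suc n) ≢ 0ℚ
1+n≢0 n eq = absurd (fromℤ-injective {+ suc n} {+ 0} eq)
  where
  absurd : + suc n ≢ + 0
  absurd ()

1-0+n≢0 : ∀ n → 1ℚ - 0ℚ + fromℕ n ≢ 0ℚ
1-0+n≢0 n = subst (_≢ 0ℚ) (fromℕ-suc n) (1+n≢0 n)

fromℕ-* : ∀ m n → fromℕ (m ℕ.* n) ≡ fromℕ m * fromℕ n
fromℕ-* m n = trans (cong fromℤ (ℤ.pos-* m n)) (fromℤ-* (+ m) (+ n))

-- Total, with value `0ℚ` at zero, so that `ratio` and `quotient` can be formed before any
-- denominator is known to be non-zero; nonvanishing enters only through `*-inv`.
inv : ℚ → ℚ
inv q with q ≟ 0ℚ
... | yes _  = 0ℚ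
... | no q≢0 = 1/_ q {{≢-nonZero q≢0}}

*-inv : ∀ {q} → q ≢ 0ℚ → q * inv q ≡ 1ℚ
*-inv {q} q≢0 with q ≟ 0ℚ
... | yes q≡0 = contradiction q≡0 q≢0
... | no  ne  = *-inverseʳ q {{≢-nonZero ne}}

*-cancelʳ-≢0 : ∀ {x y} s → s ≢ 0ℚ → x * s ≡ y * s → x ≡ y
*-cancelʳ-≢0 {x} {y} s s≢0 eq = begin
  x                ≡⟨ *-identityʳ x ⟨
  x * 1ℚ           ≡⟨ cong (x *_) (*-inv s≢0) ⟨
  x * (s * inv s)  ≡⟨ *-assoc x s (inv s) ⟨
  x * s * inv s    ≡⟨ cong (_* inv s) eq ⟩
  y * s * inv s    ≡⟨ *-assoc y s (inv s) ⟩
  y * (s * inv s)  ≡⟨ cong (y *_) (*-inv s≢0) ⟩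
  y * 1ℚ           ≡⟨ *-identityʳ y ⟩
  y                ∎
  where open ≡-Reasoning

*-≢0 : ∀ {x y} → x ≢ 0ℚ → y ≢ 0ℚ → x * y ≢ 0ℚ
*-≢0 {x} {y} x≢0 y≢0 eq = x≢0 (*-cancelʳ-≢0 y y≢0 (trans eq (sym (*-zeroˡ y))))

-- Finite sums and products over ℚ

sumTo prodTo : ℕ → (ℕ → ℚ) → ℚ
sumTo zero    f = 0ℚ
sumTo (suc n) f = sumTo n f + f n
prodTo zero    f = 1ℚ
prodTo (suc n) f = prodTo n f * f n

sumTo-cong : ∀ n {f g : ℕ → ℚ} → (∀ k → f k ≡ g k) → sumTo n f ≡ sumTo n g
sumTo-cong zero    f≗g = refl
sumTo-cong (suc n) f≗g = cong₂ _+_ (sumTo-cong n f≗g) (f≗g n)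

sumTo-linear : ∀ n c d (f g : ℕ → ℚ) →
  sumTo n (λ k → c * f k + d * g k) ≡ c * sumTo n f + d * sumTo n g
sumTo-linear zero    c d f g = identity c d
  where
  identity : ∀ c d → 0ℚ ≡ c * 0ℚ + d * 0ℚ
  identity = solve-∀ ring
sumTo-linear (suc n) c d f g =
  trans (cong (_+ (c * f n + d * g n)) (sumTo-linear n c d f g)) (identity c d (sumTo n f) (sumTo n g) (f n) (g n))
  where
  identity : ∀ c d F G x y → c * F + d * G + (c * x + d * y) ≡ c * (F + x) + d * (G + y)
  identity = solve-∀ ring

sumTo-scale : ∀ n c (f : ℕ → ℚ) → sumTo n (λ k → f k * c) ≡ sumTo n f * c
sumTo-scale zero    c f = sym (*-zeroˡ c)
sumTo-scale (suc n) c f = trans (cong (_+ f n * c) (sumTo-scale n c f)) (sym (*-distribʳ-+ c (sumTo n f) (f n)))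

prodTo-≢0 : ∀ n {f : ℕ → ℚ} → (∀ k → k ℕ.< n → f k ≢ 0ℚ) → prodTo n f ≢ 0ℚ
prodTo-≢0 zero    f≢0 = 1+n≢0 0
prodTo-≢0 (suc n) f≢0 = *-≢0 (prodTo-≢0 n (λ k k<n → f≢0 k (ℕ.m<n⇒m<1+n k<n))) (f≢0 n ℕ.≤-refl)

-- `sumTo` splits off its last term, which suits telescoping and induction on the length; the
-- library sum splits off its first.
sumTo-head : ∀ n (f : ℕ → ℚ) → f 0 + sumTo n (λ k → f (suc k)) ≡ sumTo (suc n) f
sumTo-head zero    f = +-comm (f 0) 0ℚ
sumTo-head (suc n) f =
  trans (sym (+-assoc (f 0) (sumTo n (λ k → f (suc k))) (f (suc n)))) (cong (_+ f (suc n)) (sumTo-head n f))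

sum-toℕ : ∀ n (f : ℕ → ℚ) → ∑[ k < n ] f (toℕ k) ≡ sumTo n f
sum-toℕ zero    f = refl
sum-toℕ (suc n) f = trans (cong (_+_ (f 0)) (sum-toℕ n (λ k → f (suc k)))) (sumTo-head n f)

-- quotient a x k = (a + x)_k / (1 − x)_k, so quotient a 0ℚ k = (a)_k / k!.
ratio : ℚ → ℚ → ℕ → ℚ
ratio a x j = (a + x + fromℕ j) * inv (1ℚ - x + fromℕ j)

quotient : ℚ → ℚ → ℕ → ℚ
quotient a x k = prodTo k (ratio a x)

-- Divided differences at the nodes k (k + a)

module DividedDifference (a : ℚ) (a+i≢0 : ∀ i → a + fromℕ i ≢ 0ℚ) where

  node : ℕ → ℚ
  node k = fromℕ k * (fromℕ k + a)

  -- Up to a factor independent of `k` this is 1 / ∏ (node k - node j) over j ≤ N, j ≠ k, because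
  -- node k - node j = (k - j)(k + j + a). The last quotient is (-N)_k / (1 + a + N)_k.
  weight : ℕ → ℕ → ℚ
  weight N k =
    (fromℕ k + fromℕ k + a) * quotient a 0ℚ k * quotient a (- (a + fromℕ N)) k

  private
    1+a+N+i≢0 : ∀ N i → 1ℚ - - (a + fromℕ N) + fromℕ i ≢ 0ℚ
    1+a+N+i≢0 N i eq = a+i≢0 (suc (N ℕ.+ i)) (trans
      (cong (_+_ a) (trans (fromℕ-suc (N ℕ.+ i)) (cong (_+_ 1ℚ) (fromℤ-+ (+ N) (+ i)))))
      (trans (identity a (fromℕ N) (fromℕ i)) eq))
      where
      identity : ∀ a N i → a + (1ℚ + (N + i)) ≡ 1ℚ - - (a + N) + i
      identity = solve-∀ ring

  -- Telescoping, multiplied by N so that (1 − N)_n does not appear separately.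
  weight-partial-sum : ∀ N n → fromℕ N * sumTo (suc n) (weight N) ≡
    quotient a 0ℚ n * quotient a (- (a + fromℕ N)) n * (a + fromℕ n) * (fromℕ N - fromℕ n)
  weight-partial-sum N zero = identity a (fromℕ N)
    where
    identity : ∀ a N → N * (0ℚ + (0ℚ + 0ℚ + a) * 1ℚ * 1ℚ) ≡ 1ℚ * 1ℚ * (a + 0ℚ) * (N - 0ℚ)
    identity = solve-∀ ring
  weight-partial-sum N (suc n) = begin
    fromℕ N * (S + weight N (suc n))
      ≡⟨ cong (λ n⁺ → fromℕ N * (S + (n⁺ + n⁺ + a) * c⁺ * V⁺)) (fromℕ-suc n) ⟩
    fromℕ N * (S + w)
      ≡⟨ *-distribˡ-+ (fromℕ N) S w ⟩
    fromℕ N * S + fromℕ N * w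
      ≡⟨ cong (_+ fromℕ N * w) (weight-partial-sum N n) ⟩
    X + fromℕ N * w
      ≡⟨ cong (_+ fromℕ N * w) (trans (sym (*-identityʳ X)) (trans (sym (*-identityʳ (X * 1ℚ)))
           (sym (cong₂ (λ y z → X * y * z) (*-inv (1-0+n≢0 n)) (*-inv (1+a+N+i≢0 N n)))))) ⟩
    X * ((1ℚ - 0ℚ + fromℕ n) * u) * ((1ℚ - - (a + fromℕ N) + fromℕ n) * v) + fromℕ N * w
      ≡⟨ identity a (fromℕ N) (fromℕ n) c V u v ⟩
    c * ((a + 0ℚ + fromℕ n) * u) * (V * ((a + - (a + fromℕ N) + fromℕ n) * v))
      * (a + (1ℚ + fromℕ n)) * (fromℕ N - (1ℚ + fromℕ n))
      ≡⟨ cong (λ n⁺ → c⁺ * V⁺ * (a + n⁺) * (fromℕ N - n⁺)) (fromℕ-suc n) ⟨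
    c⁺ * V⁺ * (a + fromℕ (suc n)) * (fromℕ N - fromℕ (suc n)) ∎
    where
    open ≡-Reasoning
    c = quotient a 0ℚ n
    V = quotient a (- (a + fromℕ N)) n
    u = inv (1ℚ - 0ℚ + fromℕ n)
    v = inv (1ℚ - - (a + fromℕ N) + fromℕ n)
    S = sumTo (suc n) (weight N)
    c⁺ = quotient a 0ℚ (suc n)
    V⁺ = quotient a (- (a + fromℕ N)) (suc n)
    w = (1ℚ + fromℕ n + (1ℚ + fromℕ n) + a) * c⁺ * V⁺
    X = c * V * (a + fromℕ n) * (fromℕ N - fromℕ n)
    identity : ∀ a N n c V u v →
      c * V * (a + n) * (N - n) * ((1ℚ - 0ℚ + n) * u) * ((1ℚ - - (a + N) + n) * v)
        + N * ((1ℚ + n + (1ℚ + n) + a) * (c * ((a + 0ℚ + n) * u)) * (V * ((a + - (a + N) + n) * v)))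
      ≡ c * ((a + 0ℚ + n) * u) * (V * ((a + - (a + N) + n) * v)) * (a + (1ℚ + n)) * (N - (1ℚ + n))
    identity = solve-∀ ring

  -- Passing from N to N + 1 multiplies (-N)_k by (N + 1) / (N + 1 - k) and 1 / (1 + a + N)_k by (1
  -- + a + N) / (1 + a + N + k). The two new denominators multiply to node (N + 1) - node k.
  quotient-lower : ∀ N k →
    quotient a (- (a + fromℕ (suc N))) k * (node k - node (suc N)) ≡
    - (fromℕ (suc N) * (fromℕ (suc N) + a)) * quotient a (- (a + fromℕ N)) k
  quotient-lower N zero = identity a (fromℕ (suc N))
    where
    identity : ∀ a M → 1ℚ * (0ℚ * (0ℚ + a) - M * (M + a)) ≡ - (M * (M + a)) * 1ℚ
    identity = solve-∀ ring
  quotient-lower N (suc k) = begin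
    V * ((a + - (a + m) + x) * v) * (node (suc k) - node (suc N))
      ≡⟨ cong (λ x⁺ → V * ((a + - (a + m) + x) * v) * (x⁺ * (x⁺ + a) - node (suc N))) (fromℕ-suc k) ⟩
    V * ((a + - (a + m) + x) * v) * ((1ℚ + x) * (1ℚ + x + a) - m * (m + a))
      ≡⟨ left a m x V v ⟩
    V * ((x - m) * (1ℚ + x - m)) * ((1ℚ - - (a + m) + x) * v)
      -- Both products of a denominator with its inverse are 1, so the one belonging to `suc N` is
      -- exchanged for the one belonging to `N`.
      ≡⟨ cong₂ (λ m′ e → V * ((x - m′) * (1ℚ + x - m′)) * e) (fromℕ-suc N)
           (trans (*-inv (1+a+N+i≢0 (suc N) k)) (sym (*-inv (1+a+N+i≢0 N k)))) ⟩
    V * ((x - (1ℚ + n)) * (1ℚ + x - (1ℚ + n))) * ((1ℚ - - (a + n) + x) * v′)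
      ≡⟨ right a n x V v′ ⟩
    V * (x * (x + a) - (1ℚ + n) * (1ℚ + n + a)) * ((a + - (a + n) + x) * v′)
      ≡⟨ cong (λ m′ → V * (x * (x + a) - m′ * (m′ + a)) * ((a + - (a + n) + x) * v′)) (fromℕ-suc N) ⟨
    V * (node k - node (suc N)) * ((a + - (a + n) + x) * v′)
      ≡⟨ cong (_* ((a + - (a + n) + x) * v′)) (quotient-lower N k) ⟩
    - (m * (m + a)) * V′ * ((a + - (a + n) + x) * v′)
      ≡⟨ *-assoc (- (m * (m + a))) V′ _ ⟩
    - (m * (m + a)) * (V′ * ((a + - (a + n) + x) * v′)) ∎
    where
    open ≡-Reasoning
    m = fromℕ (suc N)
    n = fromℕ N
    x = fromℕ k
    V = quotient a (- (a + m)) k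
    V′ = quotient a (- (a + n)) k
    v = inv (1ℚ - - (a + m) + x)
    v′ = inv (1ℚ - - (a + n) + x)
    left : ∀ a m x V v →
      V * ((a + - (a + m) + x) * v) * ((1ℚ + x) * (1ℚ + x + a) - m * (m + a)) ≡
      V * ((x - m) * (1ℚ + x - m)) * ((1ℚ - - (a + m) + x) * v)
    left = solve-∀ ring
    right : ∀ a n x V v →
      V * ((x - (1ℚ + n)) * (1ℚ + x - (1ℚ + n))) * ((1ℚ - - (a + n) + x) * v) ≡
      V * (x * (x + a) - (1ℚ + n) * (1ℚ + n + a)) * ((a + - (a + n) + x) * v)
    right = solve-∀ ring

  -- Multiplying by `node k - node (suc N)` deletes the last node, as in the recurrence of divided
  -- differences.
  weight-lower : ∀ N k → weight (suc N) k * (node k - node (suc N)) ≡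
    - (fromℕ (suc N) * (fromℕ (suc N) + a)) * weight N k
  weight-lower N k =
    trans (*-assoc b V _) (trans (cong (b *_) (quotient-lower N k)) (identity b C V′))
    where
    b = (fromℕ k + fromℕ k + a) * quotient a 0ℚ k
    C = - (fromℕ (suc N) * (fromℕ (suc N) + a))
    V = quotient a (- (a + fromℕ (suc N))) k
    V′ = quotient a (- (a + fromℕ N)) k
    identity : ∀ b C V → b * (C * V) ≡ C * (b * V)
    identity = solve-∀ ring

  -- (-N)_{N+1} contains the factor zero. A sum weighted by `weight N` may therefore run one index
  -- further, to match the range belonging to `suc N`.
  weight-beyond : ∀ N → weight N (suc N) ≡ 0ℚ
  weight-beyond N = identity a (fromℕ N) ((fromℕ (suc N) + fromℕ (suc N) + a) * quotient a 0ℚ (suc N))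
    (quotient a (- (a + fromℕ N)) N) (inv (1ℚ - - (a + fromℕ N) + fromℕ N))
    where
    identity : ∀ a n b V v → b * (V * ((a + - (a + n) + n) * v)) ≡ 0ℚ
    identity = solve-∀ ring

  -- Here `f` stands for a polynomial of degree at most `d` in the node: a divided difference over N
  -- + 1 nodes kills every degree below N.
  Annihilated : ℕ → (ℕ → ℚ) → Set
  Annihilated d f = ∀ N → d ℕ.< N → sumTo (suc N) (λ k → weight N k * f k) ≡ 0ℚ

  -- The telescoped sum carries the factor `fromℕ N - fromℕ n`, zero at the last index; since 0 < N,
  -- the extra factor `fromℕ N` can be cancelled.
  annihilated-1 : Annihilated 0 (λ _ → 1ℚ)
  annihilated-1 (suc N) _ = begin
    sumTo (suc (suc N)) (λ k → weight (suc N) k * 1ℚ)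
      ≡⟨ sumTo-cong (suc (suc N)) (λ k → *-identityʳ (weight (suc N) k)) ⟩
    S                          ≡⟨ *-identityˡ S ⟨
    1ℚ * S                     ≡⟨ cong (_* S) (*-inv M≢0) ⟨
    (M * inv M) * S            ≡⟨ commute M (inv M) S ⟩
    inv M * (M * S)            ≡⟨ cong (inv M *_) (weight-partial-sum (suc N) (suc N)) ⟩
    inv M * (X * (M - M))      ≡⟨ zeroʳ (inv M) X M ⟩
    0ℚ                         ∎
    where
    open ≡-Reasoning
    S = sumTo (suc (suc N)) (weight (suc N))
    M = fromℕ (suc N)
    X = quotient a 0ℚ (suc N) * quotient a (- (a + M)) (suc N) * (a + M)
    M≢0 : M ≢ 0ℚ
    M≢0 = 1+n≢0 N
    commute : ∀ M i S → (M * i) * S ≡ i * (M * S)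
    commute = solve-∀ ring
    zeroʳ : ∀ i X M → i * (X * (M - M)) ≡ 0ℚ
    zeroʳ = solve-∀ ring

  -- Split `node k - μ` at the last node. The part `node k - node (suc N)` lowers the weight to `N`,
  -- the constant part leaves `f` alone, and the hypothesis on `f` kills both.
  annihilated-linear : ∀ {d f} μ → Annihilated d f →
    Annihilated (suc d) (λ k → f k * (node k - μ))
  annihilated-linear {d} {f} μ ann (suc N) (s≤s d<N) = begin
    sumTo (suc (suc N)) (λ k → weight (suc N) k * (f k * (node k - μ)))
      ≡⟨ sumTo-cong (suc (suc N)) split ⟩
    sumTo (suc (suc N)) (λ k → C * (weight N k * f k) + D * (weight (suc N) k * f k))
      ≡⟨ sumTo-linear (suc (suc N)) C D _ _ ⟩
    C * (sumTo (suc N) (λ k → weight N k * f k) + weight N (suc N) * f (suc N))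
      + D * sumTo (suc (suc N)) (λ k → weight (suc N) k * f k)
      ≡⟨ cong₂ _+_ (cong (C *_) (cong₂ (λ y z → y + z * f (suc N)) (ann N d<N) (weight-beyond N)))
                   (cong (D *_) (ann (suc N) (ℕ.m≤n⇒m≤1+n d<N))) ⟩
    C * (0ℚ + 0ℚ * f (suc N)) + D * 0ℚ
      ≡⟨ vanish C D (f (suc N)) ⟩
    0ℚ ∎
    where
    open ≡-Reasoning
    C = - (fromℕ (suc N) * (fromℕ (suc N) + a))
    D = node (suc N) - μ
    expand : ∀ w f x y μ → w * (f * (x - μ)) ≡ w * (x - y) * f + (y - μ) * (w * f)
    expand = solve-∀ ring
    vanish : ∀ C D z → C * (0ℚ + 0ℚ * z) + D * 0ℚ ≡ 0ℚ
    vanish = solve-∀ ring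
    split : ∀ k → weight (suc N) k * (f k * (node k - μ)) ≡
      C * (weight N k * f k) + D * (weight (suc N) k * f k)
    split k = trans (expand (weight (suc N) k) (f k) (node k) (node (suc N)) μ)
      (cong (_+ D * (weight (suc N) k * f k))
        (trans (cong (_* f k) (weight-lower N k)) (*-assoc C (weight N k) (f k))))

-- Each factor equals node k + (y + l) (z − l) when y + z = a.
pairs : ℚ → ℚ → ℕ → ℕ → ℚ
pairs y z d k = prodTo d (λ l → (fromℕ k + y + fromℕ l) * (fromℕ k + z - fromℕ l))

-- Replacing `k` by `suc k` telescopes the ascending and the descending factors separately; only
-- their end factors survive, and these are cross-multiplied to avoid division.
pairs-suc : ∀ y z d k →
  pairs y z d (suc k) * ((fromℕ k + y) * (fromℕ k + z + 1ℚ - fromℕ d)) ≡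
  pairs y z d k * ((fromℕ k + y + fromℕ d) * (fromℕ k + z + 1ℚ))
pairs-suc y z zero k = identity (fromℕ k) y z
  where
  identity : ∀ k y z → 1ℚ * ((k + y) * (k + z + 1ℚ - 0ℚ)) ≡ 1ℚ * ((k + y + 0ℚ) * (k + z + 1ℚ))
  identity = solve-∀ ring
pairs-suc y z (suc d) k = begin
  P′ * ((fromℕ (suc k) + y + e) * (fromℕ (suc k) + z - e)) * ((x + y) * (x + z + 1ℚ - fromℕ (suc d)))
    ≡⟨ cong₂ (λ x⁺ e⁺ → P′ * ((x⁺ + y + e) * (x⁺ + z - e)) * ((x + y) * (x + z + 1ℚ - e⁺)))
         (fromℕ-suc k) (fromℕ-suc d) ⟩
  P′ * ((1ℚ + x + y + e) * (1ℚ + x + z - e)) * ((x + y) * (x + z + 1ℚ - (1ℚ + e)))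
    ≡⟨ left P′ x y z e ⟩
  P′ * ((x + y) * (x + z + 1ℚ - e)) * ((1ℚ + x + y + e) * (x + z - e))
    ≡⟨ cong (_* ((1ℚ + x + y + e) * (x + z - e))) (pairs-suc y z d k) ⟩
  P * ((x + y + e) * (x + z + 1ℚ)) * ((1ℚ + x + y + e) * (x + z - e))
    ≡⟨ right P x y z e ⟩
  P * ((x + y + e) * (x + z - e)) * ((x + y + (1ℚ + e)) * (x + z + 1ℚ))
    ≡⟨ cong (λ e⁺ → P * ((x + y + e) * (x + z - e)) * ((x + y + e⁺) * (x + z + 1ℚ))) (fromℕ-suc d) ⟨
  P * ((x + y + e) * (x + z - e)) * ((x + y + fromℕ (suc d)) * (x + z + 1ℚ)) ∎
  where
  open ≡-Reasoning
  x = fromℕ k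
  e = fromℕ d
  P = pairs y z d k
  P′ = pairs y z d (suc k)
  left : ∀ P x y z e →
    P * ((1ℚ + x + y + e) * (1ℚ + x + z - e)) * ((x + y) * (x + z + 1ℚ - (1ℚ + e))) ≡
    P * ((x + y) * (x + z + 1ℚ - e)) * ((1ℚ + x + y + e) * (x + z - e))
  left = solve-∀ ring
  right : ∀ P x y z e →
    P * ((x + y + e) * (x + z + 1ℚ)) * ((1ℚ + x + y + e) * (x + z - e)) ≡
    P * ((x + y + e) * (x + z - e)) * ((x + y + (1ℚ + e)) * (x + z + 1ℚ))
  right = solve-∀ ring

-- Exactly vanishing sums for the two shift quadruples

module ExactZeros
  (a h : ℚ) (t : ℕ) (a≡ : a ≡ 1ℚ + (fromℕ t + fromℕ t) - (h + h))
  (h∉ℤ : ∀ i → fromℤ i - h ≢ 0ℚ) (2h∉ℤ : ∀ i → fromℤ i - (h + h) ≢ 0ℚ) where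

  a+i≢0 : ∀ i → a + fromℕ i ≢ 0ℚ
  a+i≢0 i eq = 2h∉ℤ (+ suc (t ℕ.+ t ℕ.+ i)) (begin
    fromℕ (suc (t ℕ.+ t ℕ.+ i)) - (h + h)
      ≡⟨ cong (_- (h + h)) (trans (fromℕ-suc (t ℕ.+ t ℕ.+ i)) (cong (_+_ 1ℚ)
           (trans (fromℤ-+ (+ (t ℕ.+ t)) (+ i)) (cong (_+ fromℕ i) (fromℤ-+ (+ t) (+ t)))))) ⟩
    1ℚ + (fromℕ t + fromℕ t + fromℕ i) - (h + h)
      ≡⟨ identity (fromℕ t) (fromℕ i) h ⟩
    1ℚ + (fromℕ t + fromℕ t) - (h + h) + fromℕ i
      ≡⟨ cong (_+ fromℕ i) a≡ ⟨
    a + fromℕ i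
      ≡⟨ eq ⟩
    0ℚ ∎)
    where
    open ≡-Reasoning
    identity : ∀ t i h → 1ℚ + (t + t + i) - (h + h) ≡ 1ℚ + (t + t) - (h + h) + i
    identity = solve-∀ ring

  open DividedDifference a a+i≢0

  1-h+i≢0 : ∀ i → 1ℚ - h + fromℕ i ≢ 0ℚ
  1-h+i≢0 i eq = h∉ℤ (+ suc i) (trans (cong (_- h) (fromℕ-suc i)) (trans (identity h (fromℕ i)) eq))
    where
    identity : ∀ h i → 1ℚ + i - h ≡ 1ℚ - h + i
    identity = solve-∀ ring

  1-2h+i≢0 : ∀ i → 1ℚ - (h + h) + fromℕ i ≢ 0ℚ
  1-2h+i≢0 i eq = 2h∉ℤ (+ suc i) (trans (cong (_- (h + h)) (fromℕ-suc i)) (trans (identity (h + h) (fromℕ i)) eq))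
    where
    identity : ∀ h i → 1ℚ + i - h ≡ 1ℚ - h + i
    identity = solve-∀ ring

  annihilated-pairs : ∀ {d f} y z → y + z ≡ a → Annihilated d f →
    ∀ e → Annihilated (e ℕ.+ d) (λ k → f k * pairs y z e k)
  annihilated-pairs {d} {f} y z y+z≡a ann zero N d<N =
    trans (sumTo-cong (suc N) (λ k → cong (weight N k *_) (*-identityʳ (f k)))) (ann N d<N)
  annihilated-pairs {d} {f} y z y+z≡a ann (suc e) N d<N =
    trans (sumTo-cong (suc N) (λ k → cong (weight N k *_) (split k)))
          (annihilated-linear (- ((y + fromℕ e) * (z - fromℕ e))) (annihilated-pairs y z y+z≡a ann e) N d<N)
    where
    identity : ∀ g P k y z e → g * (P * ((k + y + e) * (k + z - e))) ≡
      g * P * (k * (k + (y + z)) - - ((y + e) * (z - e)))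
    identity = solve-∀ ring
    split : ∀ k → f k * pairs y z (suc e) k ≡
      f k * pairs y z e k * (node k - - ((y + fromℕ e) * (z - fromℕ e)))
    split k = trans (identity (f k) (pairs y z e k) (fromℕ k) y z (fromℕ e))
      (cong (λ b → f k * pairs y z e k * (fromℕ k * (fromℕ k + b) - - ((y + fromℕ e) * (z - fromℕ e)))) y+z≡a)

  T : ℚ
  T = fromℕ t

  P₁ : ℕ → ℚ
  P₁ = pairs (1ℚ - h) (T + T - h) t

  P₂ : ℕ → ℚ
  P₂ = pairs 1ℚ (a - 1ℚ) (t ℕ.+ t)

  -- Since a + h = 1 - h + 2t, the quotient (a + h)_k / (1 - h)_k is the product of the 2t factors k
  -- + 1 - h + l, normalised at k = 0. Pairing the first with the last makes the two offsets add up
  -- to `a`.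
  quotient-h : ∀ k → quotient a h k * P₁ 0 ≡ P₁ k
  quotient-h zero    = *-identityˡ (P₁ 0)
  -- For `d = t` the ascending and descending halves meet, so `s` occurs on both sides of
  -- `pairs-suc`; it is cancelled together with the denominator.
  quotient-h (suc k) = sym (*-cancelʳ-≢0 ((x + (1ℚ - h)) * s) (*-≢0 d≢0 s≢0) (begin
    P₁ (suc k) * ((x + (1ℚ - h)) * s)
      ≡⟨ cong (λ w → P₁ (suc k) * ((x + (1ℚ - h)) * w)) (s≡ x T h) ⟩
    P₁ (suc k) * ((x + (1ℚ - h)) * (x + (T + T - h) + 1ℚ - T))
      ≡⟨ pairs-suc (1ℚ - h) (T + T - h) t k ⟩
    P₁ k * (s * (x + (T + T - h) + 1ℚ))
      ≡⟨ cong₂ (λ P w → P * (s * w)) (sym (quotient-h k)) (trans (w≡ x T h) (cong (λ b → b + h + x) (sym a≡))) ⟩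
    Q * P₁ 0 * (s * (a + h + x))
      ≡⟨ cong (λ w → w * (s * (a + h + x))) (*-identityʳ (Q * P₁ 0)) ⟨
    Q * P₁ 0 * 1ℚ * (s * (a + h + x))
      ≡⟨ cong (λ w → Q * P₁ 0 * w * (s * (a + h + x))) (*-inv (1-h+i≢0 k)) ⟨
    Q * P₁ 0 * ((1ℚ - h + x) * inv (1ℚ - h + x)) * (s * (a + h + x))
      ≡⟨ identity Q (P₁ 0) x h s a (inv (1ℚ - h + x)) ⟩
    Q * ((a + h + x) * inv (1ℚ - h + x)) * P₁ 0 * ((x + (1ℚ - h)) * s) ∎))
    where
    open ≡-Reasoning
    x = fromℕ k
    s = x + (1ℚ - h) + T
    Q = quotient a h k
    comm : ∀ x h → 1ℚ - h + x ≡ x + (1ℚ - h)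
    comm = solve-∀ ring
    comm′ : ∀ x h t → 1ℚ - h + (x + t) ≡ x + (1ℚ - h) + t
    comm′ = solve-∀ ring
    d≢0 : x + (1ℚ - h) ≢ 0ℚ
    d≢0 = subst (_≢ 0ℚ) (comm x h) (1-h+i≢0 k)
    s≢0 : s ≢ 0ℚ
    s≢0 = subst (_≢ 0ℚ) (trans (cong (_+_ (1ℚ - h)) (fromℤ-+ (+ k) (+ t))) (comm′ x h T)) (1-h+i≢0 (k ℕ.+ t))
    s≡ : ∀ x t h → x + (1ℚ - h) + t ≡ x + (t + t - h) + 1ℚ - t
    s≡ = solve-∀ ring
    w≡ : ∀ x t h → x + (t + t - h) + 1ℚ ≡ 1ℚ + (t + t) - (h + h) + h + x
    w≡ = solve-∀ ring
    identity : ∀ Q P x h s a u → Q * P * ((1ℚ - h + x) * u) * (s * (a + h + x)) ≡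
      Q * ((a + h + x) * u) * P * ((x + (1ℚ - h)) * s)
    identity = solve-∀ ring

  -- The quotients match crosswise: (a + 2h)_k starts 2t above (1)_k, and (a)_k starts 2t above (1 -
  -- 2h)_k. Each linear factor of the first product pairs with one of the second.
  quotient-0-2h : ∀ k → quotient a 0ℚ k * quotient a (h + h) k * P₂ 0 ≡ P₂ k
  quotient-0-2h zero    = trans (cong (_* P₂ 0) (*-identityˡ 1ℚ)) (*-identityˡ (P₂ 0))
  quotient-0-2h (suc k) = sym (*-cancelʳ-≢0 ((1ℚ - 0ℚ + x) * (1ℚ - (h + h) + x)) (*-≢0 (1-0+n≢0 k) (1-2h+i≢0 k)) (begin
    P₂ (suc k) * ((1ℚ - 0ℚ + x) * (1ℚ - (h + h) + x))
      ≡⟨ cong (P₂ (suc k) *_) (cong₂ _*_ (comm x) (trans (left x h T) (cong₂ (λ b e → x + (b - 1ℚ) + 1ℚ - e) (sym a≡) (sym 2T)))) ⟩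
    P₂ (suc k) * ((x + 1ℚ) * (x + (a - 1ℚ) + 1ℚ - fromℕ (t ℕ.+ t)))
      ≡⟨ pairs-suc 1ℚ (a - 1ℚ) (t ℕ.+ t) k ⟩
    P₂ k * ((x + 1ℚ + fromℕ (t ℕ.+ t)) * (x + (a - 1ℚ) + 1ℚ))
      ≡⟨ cong₂ _*_ (sym (quotient-0-2h k)) (cong₂ _*_
           (trans (cong (_+_ (x + 1ℚ)) 2T) (trans (right x h T) (cong (λ b → b + (h + h) + x) (sym a≡)))) (comm′ x a)) ⟩
    Q * R * P₂ 0 * ((a + (h + h) + x) * (a + 0ℚ + x))
      ≡⟨ one (Q * R * P₂ 0) ((a + (h + h) + x) * (a + 0ℚ + x)) ⟩
    Q * R * P₂ 0 * (1ℚ * 1ℚ) * ((a + (h + h) + x) * (a + 0ℚ + x))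
      ≡⟨ cong (λ w → Q * R * P₂ 0 * w * ((a + (h + h) + x) * (a + 0ℚ + x))) (cong₂ _*_ (*-inv (1-0+n≢0 k)) (*-inv (1-2h+i≢0 k))) ⟨
    Q * R * P₂ 0 * ((1ℚ - 0ℚ + x) * u * ((1ℚ - (h + h) + x) * v)) * ((a + (h + h) + x) * (a + 0ℚ + x))
      ≡⟨ identity Q R (P₂ 0) (1ℚ - 0ℚ + x) (1ℚ - (h + h) + x) (a + (h + h) + x) (a + 0ℚ + x) u v ⟩
    Q * ((a + 0ℚ + x) * u) * (R * ((a + (h + h) + x) * v)) * P₂ 0 * ((1ℚ - 0ℚ + x) * (1ℚ - (h + h) + x)) ∎))
    where
    open ≡-Reasoning
    x = fromℕ k
    Q = quotient a 0ℚ k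
    R = quotient a (h + h) k
    u = inv (1ℚ - 0ℚ + x)
    v = inv (1ℚ - (h + h) + x)
    2T : fromℕ (t ℕ.+ t) ≡ T + T
    2T = fromℤ-+ (+ t) (+ t)
    comm : ∀ x → 1ℚ - 0ℚ + x ≡ x + 1ℚ
    comm = solve-∀ ring
    comm′ : ∀ x a → x + (a - 1ℚ) + 1ℚ ≡ a + 0ℚ + x
    comm′ = solve-∀ ring
    left : ∀ x h t → 1ℚ - (h + h) + x ≡ x + (1ℚ + (t + t) - (h + h) - 1ℚ) + 1ℚ - (t + t)
    left = solve-∀ ring
    right : ∀ x h t → x + 1ℚ + (t + t) ≡ 1ℚ + (t + t) - (h + h) + (h + h) + x
    right = solve-∀ ring
    one : ∀ X Y → X * Y ≡ X * (1ℚ * 1ℚ) * Y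
    one = solve-∀ ring
    identity : ∀ Q R P d e b c u v → Q * R * P * (d * u * (e * v)) * (b * c) ≡
      Q * (c * u) * (R * (b * v)) * P * (d * e)
    identity = solve-∀ ring

  P₁0≢0 : P₁ 0 ≢ 0ℚ
  P₁0≢0 = prodTo-≢0 t λ l _ → *-≢0
    (subst (_≢ 0ℚ) (left h (fromℕ l)) (1-h+i≢0 l))
    (subst (_≢ 0ℚ) (trans (cong (_- h) (trans (fromℤ-+ (+ t ℤ.+ + t) (ℤ.- + l))
      (cong₂ _+_ (fromℤ-+ (+ t) (+ t)) (fromℤ-neg (+ l))))) (right h T (fromℕ l))) (h∉ℤ (+ t ℤ.+ + t ℤ.- + l)))
    where
    left : ∀ h l → 1ℚ - h + l ≡ 0ℚ + (1ℚ - h) + l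
    left = solve-∀ ring
    right : ∀ h t l → t + t + - l - h ≡ 0ℚ + (t + t - h) - l
    right = solve-∀ ring

  P₂0≢0 : P₂ 0 ≢ 0ℚ
  P₂0≢0 = prodTo-≢0 (t ℕ.+ t) λ l _ → *-≢0
    (subst (_≢ 0ℚ) (left (fromℕ l)) (1-0+n≢0 l))
    (subst (_≢ 0ℚ) (trans (cong (_- (h + h)) (trans (fromℤ-+ (+ t ℤ.+ + t) (ℤ.- + l))
      (cong₂ _+_ (fromℤ-+ (+ t) (+ t)) (fromℤ-neg (+ l))))) (trans (right h T (fromℕ l)) (cong (λ b → 0ℚ + (b - 1ℚ) - fromℕ l) (sym a≡))))
      (2h∉ℤ (+ t ℤ.+ + t ℤ.- + l)))
    where
    left : ∀ l → 1ℚ - 0ℚ + l ≡ 0ℚ + 1ℚ + l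
    left = solve-∀ ring
    right : ∀ h t l → t + t + - l - (h + h) ≡ 0ℚ + (1ℚ + (t + t) - (h + h) - 1ℚ) - l
    right = solve-∀ ring

  annihilated-scaled : ∀ {d f} c (g : ℕ → ℚ) → c ≢ 0ℚ → (∀ k → g k * c ≡ f k) → Annihilated d f → Annihilated d g
  annihilated-scaled {d} {f} c g c≢0 gc≗f ann N d<N = *-cancelʳ-≢0 c c≢0 (begin
    sumTo (suc N) (λ k → weight N k * g k) * c
      ≡⟨ sumTo-scale (suc N) c _ ⟨
    sumTo (suc N) (λ k → weight N k * g k * c)
      ≡⟨ sumTo-cong (suc N) (λ k → trans (*-assoc (weight N k) (g k) c) (cong (weight N k *_) (gc≗f k))) ⟩
    sumTo (suc N) (λ k → weight N k * f k)
      ≡⟨ ann N d<N ⟩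
    0ℚ
      ≡⟨ *-zeroˡ c ⟨
    0ℚ * c ∎)
    where open ≡-Reasoning

  y₁+z₁ : 1ℚ - h + (T + T - h) ≡ a
  y₁+z₁ = trans (identity h T) (sym a≡)
    where
    identity : ∀ h t → 1ℚ - h + (t + t - h) ≡ 1ℚ + (t + t) - (h + h)
    identity = solve-∀ ring

  y₂+z₂ : 1ℚ + (a - 1ℚ) ≡ a
  y₂+z₂ = identity a
    where
    identity : ∀ a → 1ℚ + (a - 1ℚ) ≡ a
    identity = solve-∀ ring

  zero-h-h-h : ∀ N → t ℕ.+ (t ℕ.+ t) ℕ.< N →
    sumTo (suc N) (λ k → weight N k * (quotient a h k * quotient a h k * quotient a h k)) ≡ 0ℚ
  zero-h-h-h N 3t<N = annihilated-scaled (P₁ 0 * P₁ 0 * P₁ 0) _ (*-≢0 (*-≢0 P₁0≢0 P₁0≢0) P₁0≢0)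
    (λ k → trans (identity (quotient a h k) (P₁ 0)) (cong (λ w → 1ℚ * w * w * w) (quotient-h k)))
    (annihilated-pairs _ _ y₁+z₁ (annihilated-pairs _ _ y₁+z₁ (annihilated-pairs _ _ y₁+z₁ annihilated-1 t) t) t)
    N (subst (λ e → t ℕ.+ (t ℕ.+ e) ℕ.< N) (sym (ℕ.+-identityʳ t)) 3t<N)
    where
    identity : ∀ q P → q * q * q * (P * P * P) ≡ 1ℚ * (q * P) * (q * P) * (q * P)
    identity = solve-∀ ring

  zero-h-0-2h : ∀ N → t ℕ.+ (t ℕ.+ t) ℕ.< N →
    sumTo (suc N) (λ k → weight N k * (quotient a h k * quotient a 0ℚ k * quotient a (h + h) k)) ≡ 0ℚ
  zero-h-0-2h N 3t<N = annihilated-scaled (P₁ 0 * P₂ 0) _ (*-≢0 P₁0≢0 P₂0≢0)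
    (λ k → trans (identity (quotient a h k) (quotient a 0ℚ k) (quotient a (h + h) k) (P₁ 0) (P₂ 0))
      (cong₂ (λ v w → 1ℚ * v * w) (quotient-0-2h k) (quotient-h k)))
    (annihilated-pairs _ _ y₁+z₁ (annihilated-pairs _ _ y₂+z₂ annihilated-1 (t ℕ.+ t)) t)
    N (subst (λ e → t ℕ.+ e ℕ.< N) (sym (ℕ.+-identityʳ (t ℕ.+ t))) 3t<N)
    where
    identity : ∀ q r s P R → q * r * s * (P * R) ≡ 1ℚ * (r * s * R) * (q * P)
    identity = solve-∀ ring

-- The local ring ℤ₍ₚ₎

module Localisation (p : ℕ) (pr : Prime p) where

  -- Any denominator prime to `p` serves, not just the reduced one, so sums and products require no
  -- cancellation; `integral⇒coprime` passes to lowest terms.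
  record Integral (q : ℚ) : Set where
    constructor integral
    field
      den     : ℕ
      num     : ℤ
      p∤den   : ¬ (p ℕ.∣ den)
      cleared : q * fromℕ den ≡ fromℤ num

  infix 4 p^_∣_
  record p^_∣_ (m : ℕ) (q : ℚ) : Set where
    constructor multiple
    field
      cofactor          : ℚ
      cofactor-integral : Integral cofactor
      factored          : q ≡ fromℕ (p ℕ.^ m) * cofactor

  p∤1 : ¬ (p ℕ.∣ 1)
  p∤1 p∣1 = ℕ.nonTrivial⇒≢1 {{prime⇒nonTrivial pr}} (ℕ.∣1⇒≡1 p∣1)

  p∤-* : ∀ {m n} → ¬ (p ℕ.∣ m) → ¬ (p ℕ.∣ n) → ¬ (p ℕ.∣ m ℕ.* n)
  p∤-* {m} {n} p∤m p∤n p∣mn = [ p∤m , p∤n ]′ (euclidsLemma m n pr p∣mn)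

  integral-fromℤ : ∀ i → Integral (fromℤ i)
  integral-fromℤ i = integral 1 i p∤1 (*-identityʳ (fromℤ i))

  integral-+ : ∀ {x y} → Integral x → Integral y → Integral (x + y)
  integral-+ {x} {y} (integral d i p∤d xd) (integral e j p∤e ye) =
    integral (d ℕ.* e) (i ℤ.* + e ℤ.+ j ℤ.* + d) (p∤-* p∤d p∤e) (begin
      (x + y) * fromℕ (d ℕ.* e)                    ≡⟨ cong ((x + y) *_) (fromℕ-* d e) ⟩
      (x + y) * (fromℕ d * fromℕ e)                ≡⟨ identity x y (fromℕ d) (fromℕ e) ⟩
      x * fromℕ d * fromℕ e + y * fromℕ e * fromℕ d ≡⟨ cong₂ (λ u v → u * fromℕ e + v * fromℕ d) xd ye ⟩
      fromℤ i * fromℕ e + fromℤ j * fromℕ d        ≡⟨ cong₂ _+_ (fromℤ-* i (+ e)) (fromℤ-* j (+ d)) ⟨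
      fromℤ (i ℤ.* + e) + fromℤ (j ℤ.* + d)        ≡⟨ fromℤ-+ (i ℤ.* + e) (j ℤ.* + d) ⟨
      fromℤ (i ℤ.* + e ℤ.+ j ℤ.* + d)              ∎)
    where
    open ≡-Reasoning
    identity : ∀ x y d e → (x + y) * (d * e) ≡ x * d * e + y * e * d
    identity = solve-∀ ring

  integral-* : ∀ {x y} → Integral x → Integral y → Integral (x * y)
  integral-* {x} {y} (integral d i p∤d xd) (integral e j p∤e ye) =
    integral (d ℕ.* e) (i ℤ.* j) (p∤-* p∤d p∤e) (begin
      x * y * fromℕ (d ℕ.* e)       ≡⟨ cong (x * y *_) (fromℕ-* d e) ⟩
      x * y * (fromℕ d * fromℕ e)   ≡⟨ identity x y (fromℕ d) (fromℕ e) ⟩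
      x * fromℕ d * (y * fromℕ e)   ≡⟨ cong₂ _*_ xd ye ⟩
      fromℤ i * fromℤ j             ≡⟨ fromℤ-* i j ⟨
      fromℤ (i ℤ.* j)               ∎)
    where
    open ≡-Reasoning
    identity : ∀ x y d e → x * y * (d * e) ≡ x * d * (y * e)
    identity = solve-∀ ring

  integral-neg : ∀ {x} → Integral x → Integral (- x)
  integral-neg {x} (integral d i p∤d xd) = integral d (ℤ.- i) p∤d
    (trans (sym (neg-distribˡ-* x (fromℕ d))) (trans (cong -_ xd) (sym (fromℤ-neg i))))

  integral-- : ∀ {x y} → Integral x → Integral y → Integral (x - y)
  integral-- x∈ y∈ = integral-+ x∈ (integral-neg y∈)

  integral-prodTo : ∀ n {f : ℕ → ℚ} → (∀ k → k ℕ.< n → Integral (f k)) → Integral (prodTo n f)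
  integral-prodTo zero    f∈ = integral-fromℤ (+ 1)
  integral-prodTo (suc n) f∈ = integral-* (integral-prodTo n (λ k k<n → f∈ k (ℕ.m<n⇒m<1+n k<n))) (f∈ n ℕ.≤-refl)

  integral-sumTo : ∀ n {f : ℕ → ℚ} → (∀ k → k ℕ.< n → Integral (f k)) → Integral (sumTo n f)
  integral-sumTo zero    f∈ = integral-fromℤ (+ 0)
  integral-sumTo (suc n) f∈ = integral-+ (integral-sumTo n (λ k k<n → f∈ k (ℕ.m<n⇒m<1+n k<n))) (f∈ n ℕ.≤-refl)

  integral-by : ∀ {x} n i → ¬ (p ℕ.∣ ℤ.∣ n ∣) → x * fromℤ n ≡ fromℤ i → Integral x
  integral-by     (+ d)    i p∤n xn = integral d i p∤n xn
  integral-by {x} -[1+ d ] i p∤n xn = integral (suc d) (ℤ.- i) p∤n (begin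
    x * fromℕ (suc d)            ≡⟨ identity x (fromℕ (suc d)) ⟩
    - (x * - fromℕ (suc d))      ≡⟨ cong (λ y → - (x * y)) (fromℤ-neg (+ suc d)) ⟨
    - (x * fromℤ -[1+ d ])       ≡⟨ cong -_ xn ⟩
    - fromℤ i                    ≡⟨ fromℤ-neg i ⟨
    fromℤ (ℤ.- i)                ∎)
    where
    open ≡-Reasoning
    identity : ∀ x d → x * d ≡ - (x * - d)
    identity = solve-∀ ring

  unit-≢0 : ∀ {x} s n → ¬ (p ℕ.∣ ℤ.∣ n ∣) → x * fromℤ s ≡ fromℤ n → x ≢ 0ℚ
  unit-≢0 {x} s n p∤n xs x≡0 = p∤n (subst (λ i → p ℕ.∣ ℤ.∣ i ∣) {x = + 0} {y = n}
    (fromℤ-injective {+ 0} {n} (trans (sym (*-zeroˡ (fromℤ s))) (trans (cong (_* fromℤ s) (sym x≡0)) xs))) (p ℕ.∣0))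

  integral-inv : ∀ {x} s n → ¬ (p ℕ.∣ ℤ.∣ n ∣) → x * fromℤ s ≡ fromℤ n → Integral (inv x)
  integral-inv {x} s n p∤n xs = integral-by n s p∤n (begin
    inv x * fromℤ n         ≡⟨ cong (inv x *_) xs ⟨
    inv x * (x * fromℤ s)   ≡⟨ identity (inv x) x (fromℤ s) ⟩
    x * inv x * fromℤ s     ≡⟨ cong (_* fromℤ s) (*-inv {x} (unit-≢0 {x} s n p∤n xs)) ⟩
    1ℚ * fromℤ s            ≡⟨ *-identityˡ (fromℤ s) ⟩
    fromℤ s                 ∎)
    where
    open ≡-Reasoning
    identity : ∀ i x s → i * (x * s) ≡ x * i * s
    identity = solve-∀ ring

  record Unit (x : ℚ) : Set where
    constructor unit
    field
      ≢0           : x ≢ 0ℚ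
      inv-integral : Integral (inv x)

  -- The reduced denominator divides every denominator that clears `q`, so if it were divisible by
  -- `p`, then so would be the recorded one.
  integral⇒coprime : ∀ {q} → Integral q → ℕ.Coprime (↧ₙ q) p
  integral⇒coprime {q@(mkℚ n d c)} (integral e i p∤e qe) {k} (k∣d , k∣p) =
    [ (λ k≡1 → k≡1) , (λ k≡p → contradiction (ℕ.∣-trans (subst (ℕ._∣ suc d) k≡p k∣d) d∣e) p∤e) ]′
      (prime⇒irreducible pr k∣p)
    where
    cleared : ℚᵘ.mkℚᵘ n d ℚᵘ.* ℚᵘ.mkℚᵘ (+ e) 0 ℚᵘ.≃ ℚᵘ.mkℚᵘ i 0
    cleared = ℚᵘ.≃-trans (ℚᵘ.*-cong (ℚᵘ.≃-refl {ℚᵘ.mkℚᵘ n d}) (ℚᵘ.≃-sym (toℚᵘ-fromℤ (+ e))))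
      (ℚᵘ.≃-trans (ℚᵘ.≃-sym (toℚᵘ-homo-* q (fromℕ e)))
        (ℚᵘ.≃-trans (ℚᵘ.≃-reflexive (cong toℚᵘ qe)) (toℚᵘ-fromℤ i)))
    drop : ∀ {x y} → x ℚᵘ.≃ y → ℚᵘ.↥ x ℤ.* ℚᵘ.↧ y ≡ ℚᵘ.↥ y ℤ.* ℚᵘ.↧ x
    drop (ℚᵘ.*≡* eq) = eq
    ne≡id : ℤ.∣ n ∣ ℕ.* e ≡ ℤ.∣ i ∣ ℕ.* suc d
    ne≡id = begin
      ℤ.∣ n ∣ ℕ.* e                  ≡⟨ ℤ.abs-* n (+ e) ⟨
      ℤ.∣ n ℤ.* + e ∣                ≡⟨ cong ℤ.∣_∣ (ℤ.*-identityʳ (n ℤ.* + e)) ⟨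
      ℤ.∣ n ℤ.* + e ℤ.* + 1 ∣        ≡⟨ cong ℤ.∣_∣ (drop cleared) ⟩
      ℤ.∣ i ℤ.* + (suc d ℕ.* 1) ∣    ≡⟨ cong (λ s → ℤ.∣ i ℤ.* + s ∣) (ℕ.*-identityʳ (suc d)) ⟩
      ℤ.∣ i ℤ.* + suc d ∣            ≡⟨ ℤ.abs-* i (+ suc d) ⟩
      ℤ.∣ i ∣ ℕ.* suc d              ∎
      where open ≡-Reasoning
    d∣e : suc d ℕ.∣ e
    d∣e = ℕ.coprime-divisor (ℕ.coprime-sym (ℕ.recompute c)) (ℕ.divides ℤ.∣ i ∣ ne≡id)

  -- Divisibility by powers of p in the local ring

  ∣-+ : ∀ {m x y} → p^ m ∣ x → p^ m ∣ y → p^ m ∣ x + y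
  ∣-+ {m} (multiple u u∈ x≡) (multiple v v∈ y≡) =
    multiple (u + v) (integral-+ u∈ v∈) (trans (cong₂ _+_ x≡ y≡) (sym (*-distribˡ-+ (fromℕ (p ℕ.^ m)) u v)))

  ∣-scale : ∀ {m x y} → p^ m ∣ x → Integral y → p^ m ∣ x * y
  ∣-scale {m} {x} {y} (multiple u u∈ x≡) y∈ =
    multiple (u * y) (integral-* u∈ y∈) (trans (cong (_* y) x≡) (*-assoc (fromℕ (p ℕ.^ m)) u y))

  ∣-neg : ∀ {m x} → p^ m ∣ x → p^ m ∣ - x
  ∣-neg {m} {x} (multiple u u∈ x≡) =
    multiple (- u) (integral-neg u∈) (trans (cong -_ x≡) (neg-distribʳ-* (fromℕ (p ℕ.^ m)) u))

  ∣-- : ∀ {m x y} → p^ m ∣ x → p^ m ∣ y → p^ m ∣ x - y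
  ∣-- x∈ y∈ = ∣-+ x∈ (∣-neg y∈)

  fromℕ-p^ : ∀ m n → fromℕ (p ℕ.^ (m ℕ.+ n)) ≡ fromℕ (p ℕ.^ m) * fromℕ (p ℕ.^ n)
  fromℕ-p^ m n = trans (cong fromℕ (ℕ.^-distribˡ-+-* p m n)) (fromℕ-* (p ℕ.^ m) (p ℕ.^ n))

  ∣-* : ∀ {m n x y} → p^ m ∣ x → p^ n ∣ y → p^ (m ℕ.+ n) ∣ x * y
  ∣-* {m} {n} {x} {y} (multiple u u∈ x≡) (multiple v v∈ y≡) =
    multiple (u * v) (integral-* u∈ v∈) (begin
      x * y                                             ≡⟨ cong₂ _*_ x≡ y≡ ⟩
      fromℕ (p ℕ.^ m) * u * (fromℕ (p ℕ.^ n) * v)       ≡⟨ identity (fromℕ (p ℕ.^ m)) u (fromℕ (p ℕ.^ n)) v ⟩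
      fromℕ (p ℕ.^ m) * fromℕ (p ℕ.^ n) * (u * v)       ≡⟨ cong (_* (u * v)) (fromℕ-p^ m n) ⟨
      fromℕ (p ℕ.^ (m ℕ.+ n)) * (u * v)                 ∎)
    where
    open ≡-Reasoning
    identity : ∀ a u b v → a * u * (b * v) ≡ a * b * (u * v)
    identity = solve-∀ ring

  ∣-integral : ∀ {m x} → p^ m ∣ x → Integral x
  ∣-integral {m} (multiple u u∈ x≡) = subst Integral (sym x≡) (integral-* (integral-fromℤ (+ (p ℕ.^ m))) u∈)

  ∣-weaken : ∀ m {n x} → p^ (m ℕ.+ n) ∣ x → p^ m ∣ x
  ∣-weaken m {n} {x} (multiple u u∈ x≡) = multiple (fromℕ (p ℕ.^ n) * u)
    (integral-* (integral-fromℤ (+ (p ℕ.^ n))) u∈)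
    (trans x≡ (trans (cong (_* u) (fromℕ-p^ m n)) (*-assoc (fromℕ (p ℕ.^ m)) (fromℕ (p ℕ.^ n)) u)))

  ∣-0 : ∀ {m} → p^ m ∣ 0ℚ
  ∣-0 {m} = multiple 0ℚ (integral-fromℤ (+ 0)) (sym (*-zeroʳ (fromℕ (p ℕ.^ m))))

  ∣-sumTo : ∀ {m} n {f : ℕ → ℚ} → (∀ k → k ℕ.< n → p^ m ∣ f k) → p^ m ∣ sumTo n f
  ∣-sumTo zero    f∈ = ∣-0
  ∣-sumTo (suc n) f∈ = ∣-+ (∣-sumTo n (λ k k<n → f∈ k (ℕ.m<n⇒m<1+n k<n))) (f∈ n ℕ.≤-refl)

-- Expansion modulo p⁴

module Expansion (p : ℕ) (pr : Prime p) where
  open Localisation p pr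

  open Unit

  module Shifts
    (a : ℚ) (N : ℕ) (a∈ : Integral a)
    (numerator-unit : ∀ j → j ℕ.< N → Unit (a + 0ℚ + fromℕ j)) where

    Admissible : ℚ → Set
    Admissible x = ∀ j → j ℕ.< N → Unit (1ℚ - x + fromℕ j)

    ratio-integral : ∀ {x} → Integral x → Admissible x → ∀ j → j ℕ.< N → Integral (ratio a x j)
    ratio-integral x∈ adm j j<N =
      integral-* (integral-+ (integral-+ a∈ x∈) (integral-fromℤ (+ j))) (inv-integral (adm j j<N))

    quotient-integral : ∀ {x} → Integral x → Admissible x → ∀ k → k ℕ.≤ N → Integral (quotient a x k)
    quotient-integral x∈ adm k k≤N =
      integral-prodTo k (λ j j<k → ratio-integral x∈ adm j (ℕ.<-≤-trans j<k k≤N))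

    num⁻¹ den⁻¹ : ℕ → ℚ
    num⁻¹ j = inv (a + 0ℚ + fromℕ j)
    den⁻¹ j = inv (1ℚ - 0ℚ + fromℕ j)

    -- The A and B of the overview. They come from the logarithm ∑ log (1 + xᵢ α) - log (1 - xᵢ δ)
    -- with α = 1/(a + j) and δ = 1/(1 + j): for e₁ = 0 the power sums of the xᵢ are -2e₂ and 3e₃,
    -- which cancels the denominators 2 and 3.
    squares cubes : ℕ → ℚ
    squares k = sumTo k (λ j → num⁻¹ j * num⁻¹ j - den⁻¹ j * den⁻¹ j)
    cubes k = sumTo k (λ j → num⁻¹ j * num⁻¹ j * num⁻¹ j + den⁻¹ j * den⁻¹ j * den⁻¹ j)

    quartic : ℚ → ℚ → ℚ → ℚ → ℚ
    quartic e₂ e₃ e₄ b = b * b * b * b + e₂ * b * b + e₃ * b + e₄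

    quartic-unit : ∀ e₂ e₃ e₄ {b β} → b * β ≡ 1ℚ →
      quartic e₂ e₃ e₄ b ≡ b * b * b * b * (1ℚ + e₂ * (β * β) + e₃ * (β * β * β) + e₄ * (β * β * β * β))
    quartic-unit e₂ e₃ e₄ {b} {β} bβ≡1 =
      -- The hypothesis is invisible to the ring solver, so each coefficient first receives a power
      -- of `1ℚ`, and every such `1ℚ` is then replaced by `b * β`.
      trans (at-1 e₂ e₃ e₄ b) (trans (cong F (sym bβ≡1)) (at-bβ e₂ e₃ e₄ b β))
      where
      F : ℚ → ℚ
      F w = b * b * b * b + e₂ * b * b * (w * w) + e₃ * b * (w * w * w) + e₄ * (w * w * w * w)
      at-1 : ∀ e₂ e₃ e₄ b → b * b * b * b + e₂ * b * b + e₃ * b + e₄ ≡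
        b * b * b * b + e₂ * b * b * (1ℚ * 1ℚ) + e₃ * b * (1ℚ * 1ℚ * 1ℚ) + e₄ * (1ℚ * 1ℚ * 1ℚ * 1ℚ)
      at-1 = solve-∀ ring
      at-bβ : ∀ e₂ e₃ e₄ b β →
        b * b * b * b + e₂ * b * b * ((b * β) * (b * β)) + e₃ * b * ((b * β) * (b * β) * (b * β))
          + e₄ * ((b * β) * (b * β) * (b * β) * (b * β)) ≡
        b * b * b * b * (1ℚ + e₂ * (β * β) + e₃ * (β * β * β) + e₄ * (β * β * β * β))
      at-bβ = solve-∀ ring

    -- The four shifts enter through the polynomial ∏ (b + xᵢ), whose cubic
    -- coefficient vanishes.
    module FourShifts
      (x₁ x₂ x₃ x₄ e₂ e₃ e₄ : ℚ)
      (expand : ∀ b → (b + x₁) * (b + x₂) * (b + x₃) * (b + x₄) ≡ quartic e₂ e₃ e₄ b)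
      (e₂∈ : p^ 2 ∣ e₂) (e₃∈ : p^ 3 ∣ e₃) (e₄∈ : p^ 4 ∣ e₄)
      (x₁∈ : Integral x₁) (x₂∈ : Integral x₂) (x₃∈ : Integral x₃) (x₄∈ : Integral x₄)
      (adm₀ : Admissible 0ℚ)
      (adm₁ : Admissible x₁) (adm₂ : Admissible x₂) (adm₃ : Admissible x₃) (adm₄ : Admissible x₄) where

      linear : ℚ → ℚ → ℚ
      linear s c = 1ℚ + e₂ * s + e₃ * c

      -- After extraction of fourth powers the product is (1 + e₂α² + e₃α³ + e₄α⁴) / (1 + e₂δ² -
      -- e₃δ³ + e₄δ⁴). Both series are 1 modulo p², so up to p⁴ the division is a subtraction of the
      -- correction terms.
      ratio-expansion : ∀ j → j ℕ.< N →
        p^ 4 ∣ ratio a x₁ j * ratio a x₂ j * ratio a x₃ j * ratio a x₄ j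
          - ratio a 0ℚ j * ratio a 0ℚ j * ratio a 0ℚ j * ratio a 0ℚ j
            * linear (num⁻¹ j * num⁻¹ j - den⁻¹ j * den⁻¹ j)
                     (num⁻¹ j * num⁻¹ j * num⁻¹ j + den⁻¹ j * den⁻¹ j * den⁻¹ j)
      ratio-expansion j j<N = subst (p^ 4 ∣_) (sym difference)
        (∣-scale {x = remainder} remainder∈
          (integral-* (integral-* (integral-* (integral-* b∈ b∈) b∈) b∈) U∈))
        where
        open ≡-Reasoning
        n = fromℕ j
        b = a + 0ℚ + n
        e = 1ℚ - 0ℚ + n
        α = num⁻¹ j
        δ = den⁻¹ j
        u₁ = inv (1ℚ - x₁ + n)
        u₂ = inv (1ℚ - x₂ + n)
        u₃ = inv (1ℚ - x₃ + n)
        u₄ = inv (1ℚ - x₄ + n)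
        U = u₁ * u₂ * u₃ * u₄
        R = linear (α * α - δ * δ) (α * α * α + δ * δ * δ)
        b∈ = integral-+ (integral-+ a∈ (integral-fromℤ (+ 0))) (integral-fromℤ (+ j))
        α∈ = inv-integral (numerator-unit j j<N)
        δ∈ = inv-integral (adm₀ j j<N)
        U∈ = integral-* (integral-* (integral-* (inv-integral (adm₁ j j<N)) (inv-integral (adm₂ j j<N)))
               (inv-integral (adm₃ j j<N))) (inv-integral (adm₄ j j<N))
        -- `Z` is `δ-series - 1ℚ`, and `remainder` is `α-series - δ-series * R`: what is left has a
        -- factor `e₄` or is the product of `R - 1ℚ` and `Z`, both in p².
        Z = e₂ * (δ * δ) - e₃ * (δ * δ * δ) + e₄ * (δ * δ * δ * δ)
        remainder = e₄ * (α * α * α * α - δ * δ * δ * δ)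
          - (e₂ * (α * α - δ * δ) + e₃ * (α * α * α + δ * δ * δ)) * Z
        α²∈ = integral-* α∈ α∈
        δ²∈ = integral-* δ∈ δ∈
        α³∈ = integral-* α²∈ α∈
        δ³∈ = integral-* δ²∈ δ∈
        Z∈ : p^ 2 ∣ Z
        Z∈ = ∣-+ (∣-- (∣-scale e₂∈ δ²∈) (∣-weaken 2 (∣-scale e₃∈ δ³∈))) (∣-weaken 2 (∣-scale e₄∈ (integral-* δ³∈ δ∈)))
        remainder∈ : p^ 4 ∣ remainder
        remainder∈ = ∣-- (∣-scale e₄∈ (integral-- (integral-* α³∈ α∈) (integral-* δ³∈ δ∈)))
          (∣-* (∣-+ (∣-scale e₂∈ (integral-- α²∈ δ²∈)) (∣-weaken 2 (∣-scale e₃∈ (integral-+ α³∈ δ³∈)))) Z∈)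
        numerator : (a + x₁ + n) * (a + x₂ + n) * (a + x₃ + n) * (a + x₄ + n) ≡ quartic e₂ e₃ e₄ b
        numerator = trans (cong₂ _*_ (cong₂ _*_ (cong₂ _*_ (swap a x₁ n) (swap a x₂ n)) (swap a x₃ n)) (swap a x₄ n)) (expand b)
          where
          swap : ∀ a x n → a + x + n ≡ a + 0ℚ + n + x
          swap = solve-∀ ring
        denominator : (1ℚ - x₁ + n) * (1ℚ - x₂ + n) * (1ℚ - x₃ + n) * (1ℚ - x₄ + n) ≡ quartic e₂ (- e₃) e₄ e
        -- Four sign changes cancel, so the product is the quartic at `- e`; only its odd
        -- coefficient changes sign.
        denominator = trans (signs x₁ x₂ x₃ x₄ n) (trans (expand (- e)) (even e₂ e₃ e₄ e))
          where
          signs : ∀ x₁ x₂ x₃ x₄ n →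
            (1ℚ - x₁ + n) * (1ℚ - x₂ + n) * (1ℚ - x₃ + n) * (1ℚ - x₄ + n) ≡
            (- (1ℚ - 0ℚ + n) + x₁) * (- (1ℚ - 0ℚ + n) + x₂) * (- (1ℚ - 0ℚ + n) + x₃) * (- (1ℚ - 0ℚ + n) + x₄)
          signs = solve-∀ ring
          even : ∀ e₂ e₃ e₄ e → - e * - e * - e * - e + e₂ * - e * - e + e₃ * - e + e₄ ≡
            e * e * e * e + e₂ * e * e + - e₃ * e + e₄
          even = solve-∀ ring
        EU≡1 : quartic e₂ (- e₃) e₄ e * U ≡ 1ℚ
        EU≡1 = begin
          quartic e₂ (- e₃) e₄ e * U
            ≡⟨ cong (_* U) denominator ⟨
          (1ℚ - x₁ + n) * (1ℚ - x₂ + n) * (1ℚ - x₃ + n) * (1ℚ - x₄ + n) * U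
            ≡⟨ regroup (1ℚ - x₁ + n) (1ℚ - x₂ + n) (1ℚ - x₃ + n) (1ℚ - x₄ + n) u₁ u₂ u₃ u₄ ⟩
          (1ℚ - x₁ + n) * u₁ * ((1ℚ - x₂ + n) * u₂) * ((1ℚ - x₃ + n) * u₃) * ((1ℚ - x₄ + n) * u₄)
            ≡⟨ cong₂ _*_ (cong₂ _*_ (cong₂ _*_ (*-inv {1ℚ - x₁ + n} (≢0 (adm₁ j j<N))) (*-inv {1ℚ - x₂ + n} (≢0 (adm₂ j j<N))))
                 (*-inv {1ℚ - x₃ + n} (≢0 (adm₃ j j<N)))) (*-inv {1ℚ - x₄ + n} (≢0 (adm₄ j j<N))) ⟩
          1ℚ ∎
          where
          regroup : ∀ a b c d u v w z → a * b * c * d * (u * v * w * z) ≡ a * u * (b * v) * (c * w) * (d * z)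
          regroup = solve-∀ ring
        α-series = 1ℚ + e₂ * (α * α) + e₃ * (α * α * α) + e₄ * (α * α * α * α)
        δ-series = 1ℚ + e₂ * (δ * δ) + - e₃ * (δ * δ * δ) + e₄ * (δ * δ * δ * δ)
        B = b * b * b * b
        bδ⁴ = b * δ * (b * δ) * (b * δ) * (b * δ)
        cancel : bδ⁴ * quartic e₂ (- e₃) e₄ e ≡ B * δ-series
        cancel = begin
          bδ⁴ * quartic e₂ (- e₃) e₄ e
            ≡⟨ cong (bδ⁴ *_) (quartic-unit e₂ (- e₃) e₄ {e} {δ} (*-inv {e} (≢0 (adm₀ j j<N)))) ⟩
          bδ⁴ * (e * e * e * e * δ-series)
            ≡⟨ regroup b δ e δ-series ⟩
          B * (e * δ * (e * δ) * (e * δ) * (e * δ)) * δ-series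
            ≡⟨ cong (λ w → B * (w * w * w * w) * δ-series) (*-inv {e} (≢0 (adm₀ j j<N))) ⟩
          B * (1ℚ * 1ℚ * 1ℚ * 1ℚ) * δ-series
            ≡⟨ cong (_* δ-series) (*-identityʳ B) ⟩
          B * δ-series ∎
          where
          regroup : ∀ b δ e s → b * δ * (b * δ) * (b * δ) * (b * δ) * (e * e * e * e * s) ≡
            b * b * b * b * (e * δ * (e * δ) * (e * δ) * (e * δ)) * s
          regroup = solve-∀ ring
        difference : ratio a x₁ j * ratio a x₂ j * ratio a x₃ j * ratio a x₄ j - bδ⁴ * R ≡ remainder * (B * U)
        difference = begin
          ratio a x₁ j * ratio a x₂ j * ratio a x₃ j * ratio a x₄ j - bδ⁴ * R
            -- The second term is multiplied by `E * U`, which is 1. Then `U` is a common factor and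
            -- no inverse of a quartic has to be formed.
            ≡⟨ cong₂ _-_ (regroup (a + x₁ + n) (a + x₂ + n) (a + x₃ + n) (a + x₄ + n) u₁ u₂ u₃ u₄) (trans (sym (*-identityʳ (bδ⁴ * R))) (cong (bδ⁴ * R *_) (sym EU≡1))) ⟩
          (a + x₁ + n) * (a + x₂ + n) * (a + x₃ + n) * (a + x₄ + n) * U - bδ⁴ * R * (E * U)
            ≡⟨ cong₂ _-_ (cong (_* U) (trans numerator (quartic-unit e₂ e₃ e₄ {b} {α} (*-inv {b} (≢0 (numerator-unit j j<N))))))
                 (regroup′ bδ⁴ R E U) ⟩
          B * α-series * U - bδ⁴ * E * (R * U)
            ≡⟨ cong (λ w → B * α-series * U - w * (R * U)) cancel ⟩
          B * α-series * U - B * δ-series * (R * U)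
            ≡⟨ identity B U e₂ e₃ e₄ α δ ⟩
          remainder * (B * U) ∎
          where
          E = quartic e₂ (- e₃) e₄ e
          regroup : ∀ a b c d u v w z → a * u * (b * v) * (c * w) * (d * z) ≡ a * b * c * d * (u * v * w * z)
          regroup = solve-∀ ring
          regroup′ : ∀ b r e u → b * r * (e * u) ≡ b * e * (r * u)
          regroup′ = solve-∀ ring
          identity : ∀ B U e₂ e₃ e₄ α δ →
            B * (1ℚ + e₂ * (α * α) + e₃ * (α * α * α) + e₄ * (α * α * α * α)) * U
            - B * (1ℚ + e₂ * (δ * δ) + - e₃ * (δ * δ * δ) + e₄ * (δ * δ * δ * δ))
              * ((1ℚ + e₂ * (α * α - δ * δ) + e₃ * (α * α * α + δ * δ * δ)) * U)
            ≡ (e₄ * (α * α * α * α - δ * δ * δ * δ)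
              - (e₂ * (α * α - δ * δ) + e₃ * (α * α * α + δ * δ * δ))
                * (e₂ * (δ * δ) - e₃ * (δ * δ * δ) + e₄ * (δ * δ * δ * δ))) * (B * U)
          identity = solve-∀ ring

      -- In (1 + σ)(1 + σ′) = 1 + σ + σ′ + σσ′ both σ and σ′ lie in p², so modulo p⁴ the corrections
      -- of successive ratios simply add.
      quotient-expansion : ∀ k → k ℕ.≤ N →
        p^ 4 ∣ quotient a x₁ k * quotient a x₂ k * quotient a x₃ k * quotient a x₄ k
          - quotient a 0ℚ k * quotient a 0ℚ k * quotient a 0ℚ k * quotient a 0ℚ k
            * linear (squares k) (cubes k)
      quotient-expansion zero    _   = subst (p^ 4 ∣_) (identity e₂ e₃) ∣-0
        where
        identity : ∀ e₂ e₃ → 0ℚ ≡ 1ℚ * 1ℚ * 1ℚ * 1ℚ - 1ℚ * 1ℚ * 1ℚ * 1ℚ * (1ℚ + e₂ * 0ℚ + e₃ * 0ℚ)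
        identity = solve-∀ ring
      quotient-expansion (suc k) k<N = subst (p^ 4 ∣_)
        (identity (q x₁) (q x₂) (q x₃) (q x₄) (r x₁) (r x₂) (r x₃) (r x₄) c ρ e₂ e₃ s t s′ t′)
        (∣-+ (∣-+ (∣-scale (quotient-expansion k k≤N) g∈) (∣-scale (ratio-expansion k k<N) (integral-* c⁴∈ R∈)))
          (∣-scale (∣-* (increment s∈ t∈) (increment s′∈ t′∈)) (integral-* c⁴∈ ρ⁴∈)))
        where
        q r : ℚ → ℚ
        q x = quotient a x k
        r x = ratio a x k
        c = quotient a 0ℚ k
        ρ = ratio a 0ℚ k
        α = num⁻¹ k
        δ = den⁻¹ k
        s = squares k
        t = cubes k
        s′ = α * α - δ * δ
        t′ = α * α * α + δ * δ * δ
        k≤N = ℕ.<⇒≤ k<N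
        fourth : ∀ {x} → Integral x → Integral (x * x * x * x)
        fourth x∈ = integral-* (integral-* (integral-* x∈ x∈) x∈) x∈
        0∈ = integral-fromℤ (+ 0)
        c⁴∈ = fourth (quotient-integral 0∈ adm₀ k k≤N)
        ρ⁴∈ = fourth (ratio-integral 0∈ adm₀ k k<N)
        g∈ = integral-* (integral-* (integral-* (ratio-integral x₁∈ adm₁ k k<N) (ratio-integral x₂∈ adm₂ k k<N))
          (ratio-integral x₃∈ adm₃ k k<N)) (ratio-integral x₄∈ adm₄ k k<N)
        square-integral : ∀ j → j ℕ.< N → Integral (num⁻¹ j * num⁻¹ j - den⁻¹ j * den⁻¹ j)
        square-integral j j<N = integral-- (integral-* α∈ α∈) (integral-* δ∈ δ∈)
          where
          α∈ = inv-integral (numerator-unit j j<N)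
          δ∈ = inv-integral (adm₀ j j<N)
        cube-integral : ∀ j → j ℕ.< N → Integral (num⁻¹ j * num⁻¹ j * num⁻¹ j + den⁻¹ j * den⁻¹ j * den⁻¹ j)
        cube-integral j j<N = integral-+ (integral-* (integral-* α∈ α∈) α∈) (integral-* (integral-* δ∈ δ∈) δ∈)
          where
          α∈ = inv-integral (numerator-unit j j<N)
          δ∈ = inv-integral (adm₀ j j<N)
        s∈ = integral-sumTo k (λ j j<k → square-integral j (ℕ.<-trans j<k k<N))
        t∈ = integral-sumTo k (λ j j<k → cube-integral j (ℕ.<-trans j<k k<N))
        s′∈ = square-integral k k<N
        t′∈ = cube-integral k k<N
        increment : ∀ {s t} → Integral s → Integral t → p^ 2 ∣ e₂ * s + e₃ * t
        increment s∈ t∈ = ∣-+ (∣-scale e₂∈ s∈) (∣-weaken 2 (∣-scale e₃∈ t∈))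
        R∈ : Integral (linear s t)
        R∈ = integral-+ (integral-+ (integral-fromℤ (+ 1)) (∣-integral (∣-scale e₂∈ s∈))) (∣-integral (∣-scale e₃∈ t∈))
        identity : ∀ q₁ q₂ q₃ q₄ r₁ r₂ r₃ r₄ c ρ e₂ e₃ s t s′ t′ →
          (q₁ * q₂ * q₃ * q₄ - c * c * c * c * (1ℚ + e₂ * s + e₃ * t)) * (r₁ * r₂ * r₃ * r₄)
          + (r₁ * r₂ * r₃ * r₄ - ρ * ρ * ρ * ρ * (1ℚ + e₂ * s′ + e₃ * t′)) * (c * c * c * c * (1ℚ + e₂ * s + e₃ * t))
          + (e₂ * s + e₃ * t) * (e₂ * s′ + e₃ * t′) * (c * c * c * c * (ρ * ρ * ρ * ρ))
          ≡ q₁ * r₁ * (q₂ * r₂) * (q₃ * r₃) * (q₄ * r₄)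
          - c * ρ * (c * ρ) * (c * ρ) * (c * ρ) * (1ℚ + e₂ * (s + s′) + e₃ * (t + t′))
        identity = solve-∀ ring

-- The congruence for a = m − 2h and p = 2t + 2M + 1

module Congruence (p : ℕ) (pr : Prime p)
  (a h : ℚ) (t M : ℕ) (p≡ : p ≡ t ℕ.+ t ℕ.+ suc (M ℕ.+ M))
  (3t<N : t ℕ.+ (t ℕ.+ t) ℕ.< M ℕ.+ M)
  (a≡ : a ≡ 1ℚ + (fromℕ t + fromℕ t) - (h + h))
  (a+N≡3h : a + fromℕ (M ℕ.+ M) ≡ h + h + h)
  (h∉ℤ : ∀ i → fromℤ i - h ≢ 0ℚ) (2h∉ℤ : ∀ i → fromℤ i - (h + h) ≢ 0ℚ)
  where
  open Localisation p pr
  open Expansion p pr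
  open Unit

  module _
    (h∈ : p^ 1 ∣ h) (a∈ : Integral a)
    (numerator-unit : ∀ j → j ℕ.< M ℕ.+ M → Unit (a + 0ℚ + fromℕ j))
    (unit-0  : ∀ j → suc j ℕ.< p → Unit (1ℚ - 0ℚ + fromℕ j))
    (unit-h  : ∀ j → j ℕ.< M ℕ.+ M → Unit (1ℚ - h + fromℕ j))
    (unit-2h : ∀ j → j ℕ.< M ℕ.+ M → Unit (1ℚ - (h + h) + fromℕ j))
    (unit-3h : ∀ j → j ℕ.< M ℕ.+ M → Unit (1ℚ - - (a + fromℕ (M ℕ.+ M)) + fromℕ j))
    where

    N : ℕ
    N = M ℕ.+ M

    sN≤p : suc N ℕ.≤ p
    sN≤p = subst (suc N ℕ.≤_) (sym p≡) (ℕ.m≤n+m (suc N) (t ℕ.+ t))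

    open Shifts a N a∈ numerator-unit
    open ExactZeros a h t a≡ h∉ℤ 2h∉ℤ using (a+i≢0; zero-h-h-h; zero-h-0-2h)
    open DividedDifference a a+i≢0 using (weight)

    c : ℕ → ℚ
    c = quotient a 0ℚ

    adm₀ : Admissible 0ℚ
    adm₀ j j<N = unit-0 j (ℕ.<-≤-trans (s≤s j<N) sN≤p)

    0∈ : Integral 0ℚ
    0∈ = integral-fromℤ (+ 0)

    3h∈ : p^ 1 ∣ h + h + h
    3h∈ = ∣-+ (∣-+ h∈ h∈) h∈

    c∈ : ∀ k → k ℕ.≤ N → Integral (c k)
    c∈ = quotient-integral 0∈ adm₀

    cubes∈ : ∀ k → k ℕ.≤ N → Integral (cubes k)
    cubes∈ k k≤N = integral-sumTo k λ j j<k →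
      let α∈ = inv-integral (numerator-unit j (ℕ.<-≤-trans j<k k≤N))
          δ∈ = inv-integral (adm₀ j (ℕ.<-≤-trans j<k k≤N))
      in integral-+ (integral-* (integral-* α∈ α∈) α∈) (integral-* (integral-* δ∈ δ∈) δ∈)

    -- Reflection k ↦ N - k modulo p

    complement : ∀ c d → suc (c ℕ.+ d) ≡ N → a + (1ℚ + (fromℕ c + fromℕ d)) ≡ h + h + h
    complement c d c+d+1≡N = trans (cong (_+_ a) (sym (trans (cong fromℕ (sym c+d+1≡N))
      (trans (fromℕ-suc (c ℕ.+ d)) (cong (_+_ 1ℚ) (fromℤ-+ (+ c) (+ d))))))) a+N≡3h

    module _ {c d : ℕ} (c+d+1≡N : suc (c ℕ.+ d) ≡ N) where
      private
        x = fromℕ c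
        y = fromℕ d
        c<N : c ℕ.< N
        c<N = subst (c ℕ.<_) c+d+1≡N (s≤s (ℕ.m≤m+n c d))
        d<N : d ℕ.< N
        d<N = subst (d ℕ.<_) c+d+1≡N (s≤s (ℕ.m≤n+m d c))
        S = a + (1ℚ + (x + y))
        S∈ : p^ 1 ∣ S
        S∈ = subst (p^ 1 ∣_) (sym (complement c d c+d+1≡N)) 3h∈

      -- Since `S` is 3h, modulo p the numerator a + c is -(1 + d) and a + d is -(1 + c): each
      -- numerator cancels the denominator at the mirrored index.
      mirror-ratio : p^ 1 ∣ ratio a 0ℚ c * ratio a 0ℚ d - 1ℚ
      mirror-ratio = subst (p^ 1 ∣_) equation (∣-scale S∈
        (integral-* (integral-- (integral-- (∣-integral S∈) (x∈ c)) (x∈ d)) (integral-* (inv-integral (adm₀ c c<N)) (inv-integral (adm₀ d d<N)))))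
        where
        x∈ : ∀ j → Integral (1ℚ - 0ℚ + fromℕ j)
        x∈ j = integral-+ (integral-fromℤ (+ 1)) (integral-fromℤ (+ j))
        u = den⁻¹ c
        v = den⁻¹ d
        identity : ∀ a x y u v →
          (a + (1ℚ + (x + y))) * ((a + (1ℚ + (x + y)) - (1ℚ - 0ℚ + x) - (1ℚ - 0ℚ + y)) * (u * v)) ≡
          (a + 0ℚ + x) * u * ((a + 0ℚ + y) * v) - (1ℚ - 0ℚ + x) * u * ((1ℚ - 0ℚ + y) * v)
        identity = solve-∀ ring
        equation : S * ((S - (1ℚ - 0ℚ + x) - (1ℚ - 0ℚ + y)) * (u * v)) ≡ ratio a 0ℚ c * ratio a 0ℚ d - 1ℚ
        equation = trans (identity a x y u v) (cong (λ w → ratio a 0ℚ c * ratio a 0ℚ d - w)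
          (cong₂ _*_ (*-inv {1ℚ - 0ℚ + x} (≢0 (adm₀ c c<N))) (*-inv {1ℚ - 0ℚ + y} (≢0 (adm₀ d d<N)))))

      -- The reciprocals of a + c and 1 + d add up to `S` times their product.
      mirror-inverses : p^ 1 ∣ num⁻¹ c + den⁻¹ d
      mirror-inverses = subst (p^ 1 ∣_) equation
        (∣-scale S∈ (integral-* (inv-integral (numerator-unit c c<N)) (inv-integral (adm₀ d d<N))))
        where
        α = num⁻¹ c
        δ = den⁻¹ d
        identity : ∀ a x y α δ → (a + (1ℚ + (x + y))) * (α * δ) ≡ (1ℚ - 0ℚ + y) * δ * α + (a + 0ℚ + x) * α * δ
        identity = solve-∀ ring
        equation : S * (α * δ) ≡ α + δ
        equation = trans (identity a x y α δ) (trans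
          (cong₂ (λ v w → v * α + w * δ) (*-inv {1ℚ - 0ℚ + y} (≢0 (adm₀ d d<N))) (*-inv {a + 0ℚ + x} (≢0 (numerator-unit c c<N))))
          (cong₂ _+_ (*-identityˡ α) (*-identityˡ δ)))

      mirror-cubed : p^ 1 ∣ num⁻¹ c * num⁻¹ c * num⁻¹ c + den⁻¹ d * den⁻¹ d * den⁻¹ d
      mirror-cubed = subst (p^ 1 ∣_) (identity (num⁻¹ c) (den⁻¹ d))
        (∣-scale mirror-inverses (integral-+ (integral-- (integral-* α∈ α∈) (integral-* α∈ δ∈)) (integral-* δ∈ δ∈)))
        where
        α∈ = inv-integral (numerator-unit c c<N)
        δ∈ = inv-integral (adm₀ d d<N)
        identity : ∀ α δ → (α + δ) * (α * α - α * δ + δ * δ) ≡ α * α * α + δ * δ * δ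
        identity = solve-∀ ring

    mirror-index : ∀ {i c} → c ℕ.+ suc i ≡ M → suc (c ℕ.+ (i ℕ.+ M)) ≡ N
    mirror-index {i} {c} eq = trans (sym (cong suc (ℕ.+-assoc c i M))) (cong (ℕ._+ M) (trans (sym (ℕ.+-suc c i)) eq))

    upper≤N : ∀ {i c} → c ℕ.+ i ≡ M → i ℕ.+ M ℕ.≤ N
    upper≤N {i} {c} eq = ℕ.+-monoˡ-≤ M (subst (i ℕ.≤_) eq (ℕ.m≤n+m i c))

    lower≤N : ∀ {i c} → c ℕ.+ i ≡ M → c ℕ.≤ N
    lower≤N {i} {c} eq = ℕ.≤-trans (subst (c ℕ.≤_) eq (ℕ.m≤m+n c i)) (ℕ.m≤m+n M M)

    shift-index : ∀ {i c} → c ℕ.+ suc i ≡ M → suc c ℕ.+ i ≡ M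
    shift-index {i} {c} eq = trans (sym (ℕ.+-suc c i)) eq

    ∣-self : ∀ {m} x → p^ m ∣ x - x
    ∣-self x = subst (p^ _ ∣_) (sym (+-inverseʳ x)) ∣-0

    -- The indices `i + M` and `k` are mirror images, as they add up to N. Each step outwards from
    -- the middle adds one ratio above and removes one below, and the product of these two ratios is
    -- 1 modulo p.
    mirror-quotient : ∀ i k → k ℕ.+ i ≡ M → p^ 1 ∣ c (i ℕ.+ M) - c k
    mirror-quotient zero    k eq = subst (λ m → p^ 1 ∣ c M - c m) (sym (trans (sym (ℕ.+-identityʳ k)) eq)) (∣-self (c M))
    mirror-quotient (suc i) k eq = subst (p^ 1 ∣_)
      (identity (c (i ℕ.+ M)) (c k) (ratio a 0ℚ k) (ratio a 0ℚ (i ℕ.+ M)))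
      (∣-+ (∣-scale (mirror-quotient i (suc k) (shift-index eq)) (ratio-integral 0∈ adm₀ (i ℕ.+ M) (upper≤N eq)))
           (∣-scale (mirror-ratio {k} {i ℕ.+ M} (mirror-index eq)) (c∈ k (lower≤N eq))))
      where
      identity : ∀ Q q r R → (Q - q * r) * R + (r * R - 1ℚ) * q ≡ Q * R - q
      identity = solve-∀ ring

    mirror-cubes : ∀ i k → k ℕ.+ i ≡ M → p^ 1 ∣ cubes (i ℕ.+ M) - cubes k
    mirror-cubes zero    k eq = subst (λ m → p^ 1 ∣ cubes M - cubes m) (sym (trans (sym (ℕ.+-identityʳ k)) eq)) (∣-self (cubes M))
    mirror-cubes (suc i) k eq = subst (p^ 1 ∣_)
      (identity (cubes (i ℕ.+ M)) (cubes k)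
        (num⁻¹ k * num⁻¹ k * num⁻¹ k) (den⁻¹ k * den⁻¹ k * den⁻¹ k)
        (num⁻¹ d * num⁻¹ d * num⁻¹ d) (den⁻¹ d * den⁻¹ d * den⁻¹ d))
      (∣-+ (mirror-cubes i (suc k) (shift-index eq))
        -- The cancellation is crosswise: the numerator inverse at each of `k` and `d` meets the
        -- denominator inverse at the other.
        (∣-+ (mirror-cubed {k} {d} (mirror-index eq)) (mirror-cubed {d} {k} (trans (cong suc (ℕ.+-comm d k)) (mirror-index eq)))))
      where
      d = i ℕ.+ M
      identity : ∀ B b s t u v → B - (b + (s + t)) + (s + v + (u + t)) ≡ B + (u + v) - b
      identity = solve-∀ ring

    fifth : ℚ → ℚ
    fifth x = x * x * x * x * x

    fifth∈ : ∀ {x} → Integral x → Integral (fifth x)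
    fifth∈ x∈ = integral-* (integral-* (integral-* (integral-* x∈ x∈) x∈) x∈) x∈

    ∣-difference-* : ∀ {m} x x′ y y′ → Integral y → Integral x′ → p^ m ∣ x - x′ → p^ m ∣ y - y′ → p^ m ∣ x * y - x′ * y′
    ∣-difference-* {m} x x′ y y′ y∈ x′∈ x~ y~ = subst (p^ m ∣_) (identity x x′ y y′)
      (∣-+ (∣-scale x~ y∈) (∣-scale y~ x′∈))
      where
      identity : ∀ x x′ y y′ → (x - x′) * y + (y - y′) * x′ ≡ x * y - x′ * y′
      identity = solve-∀ ring

    g : ℕ → ℚ
    g k = (fromℕ k + fromℕ k + a) * (fifth (c k) * cubes k)

    -- The linear factors at mirrored indices add up to 2(a + N) = 6h, while the remaining factors
    -- agree modulo p.
    g-antisymmetric : ∀ i k → k ℕ.+ i ≡ M → p^ 1 ∣ g k + g (i ℕ.+ M)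
    g-antisymmetric i k eq = subst (p^ 1 ∣_) equation
      (∣-+ (∣-scale (∣-+ 3h∈ 3h∈) Y∈) (∣-neg (∣-scale Y~X (integral-+ (integral-+ (integral-fromℤ (+ k)) (integral-fromℤ (+ k))) a∈))))
      where
      d = i ℕ.+ M
      x = fromℕ k
      y = fromℕ d
      Q = c d
      q = c k
      X = fifth (c k) * cubes k
      Y = fifth (c d) * cubes d
      k≤N = lower≤N eq
      d≤N = upper≤N eq
      Q∈ = c∈ d d≤N
      q∈ = c∈ k k≤N
      q~ = mirror-quotient i k eq
      Y∈ : Integral Y
      Y∈ = integral-* (fifth∈ Q∈) (cubes∈ d d≤N)
      Y~X : p^ 1 ∣ Y - X
      Y~X = ∣-difference-* (fifth Q) (fifth q) (cubes d) (cubes k) (cubes∈ d d≤N) (fifth∈ q∈)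
        (∣-difference-* (Q * Q * Q * Q) (q * q * q * q) Q q Q∈ (integral-* (integral-* (integral-* q∈ q∈) q∈) q∈)
          (∣-difference-* (Q * Q * Q) (q * q * q) Q q Q∈ (integral-* (integral-* q∈ q∈) q∈)
            (∣-difference-* (Q * Q) (q * q) Q q Q∈ (integral-* q∈ q∈) (∣-difference-* Q q Q q Q∈ q∈ q~ q~) q~) q~) q~)
        (mirror-cubes i k eq)
      k+d≡N : k ℕ.+ d ≡ N
      k+d≡N = trans (sym (ℕ.+-assoc k i M)) (cong (ℕ._+ M) eq)
      3h≡ : h + h + h ≡ a + (x + y)
      3h≡ = trans (sym a+N≡3h) (cong (_+_ a) (trans (cong fromℕ (sym k+d≡N)) (fromℤ-+ (+ k) (+ d))))
      identity : ∀ a x y X Y →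
        (a + (x + y) + (a + (x + y))) * Y + - ((Y - X) * (x + x + a)) ≡ (x + x + a) * X + (y + y + a) * Y
      identity = solve-∀ ring
      equation : (h + h + h + (h + h + h)) * Y + - ((Y - X) * (x + x + a)) ≡ g k + g d
      equation = trans (cong (λ s → (s + s) * Y + - ((Y - X) * (x + x + a))) 3h≡) (identity a x y X Y)

    -- The middle index is its own mirror image, and its linear factor 2M + a is a + N = 3h.
    g-middle : p^ 1 ∣ g M
    g-middle = subst (p^ 1 ∣_) (cong (_* (fifth (c M) * cubes M)) equation)
      (∣-scale 3h∈ (integral-* (fifth∈ (c∈ M M≤N)) (cubes∈ M M≤N)))
      where
      M≤N = ℕ.m≤m+n M M
      equation : h + h + h ≡ fromℕ M + fromℕ M + a
      equation = trans (sym a+N≡3h) (trans (cong (_+_ a) (fromℤ-+ (+ M) (+ M))) (+-comm a (fromℕ M + fromℕ M)))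

    -- Pairing from the middle outwards avoids a division by 2.
    sum-g-window : ∀ i k → k ℕ.+ i ≡ M → p^ 1 ∣ sumTo (suc (i ℕ.+ M)) g - sumTo k g
    sum-g-window zero    k eq = subst (λ m → p^ 1 ∣ sumTo (suc M) g - sumTo m g) (sym (trans (sym (ℕ.+-identityʳ k)) eq))
      (subst (p^ 1 ∣_) (identity (sumTo M g) (g M)) g-middle)
      where
      identity : ∀ S x → x ≡ S + x - S
      identity = solve-∀ ring
    sum-g-window (suc i) k eq = subst (p^ 1 ∣_)
      (identity (sumTo (suc (i ℕ.+ M)) g) (sumTo k g) (g k) (g (suc i ℕ.+ M)))
      (∣-+ (sum-g-window i (suc k) (shift-index eq)) (g-antisymmetric (suc i) k eq))
      where
      identity : ∀ S s x y → S - (s + x) + (x + y) ≡ S + y - s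
      identity = solve-∀ ring

    sum-g : p^ 1 ∣ sumTo (suc N) g
    sum-g = subst (p^ 1 ∣_) (+-identityʳ (sumTo (suc N) g)) (sum-g-window M 0 refl)

    -- Combination of the two shift quadruples modulo p⁴

    h²∈ : p^ 2 ∣ h * h
    h²∈ = ∣-* h∈ h∈

    h³∈ : p^ 3 ∣ h * h * h
    h³∈ = ∣-* h²∈ h∈

    h⁴∈ : p^ 4 ∣ h * h * h * h
    h⁴∈ = ∣-* h³∈ h∈

    -- Equal to -3h, but kept in the form occurring in `weight N`, so that the weight contains
    -- `quotient a x₁` by definition.
    x₁ : ℚ
    x₁ = - (a + fromℕ N)

    x₁∈ : Integral x₁
    x₁∈ = integral-neg (integral-+ a∈ (integral-fromℤ (+ N)))

    h-integral : Integral h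
    h-integral = ∣-integral h∈

    expand₁ : ∀ b → (b + x₁) * (b + h) * (b + h) * (b + h) ≡
      quartic (h * h * - fromℕ 6) (h * h * h * - fromℕ 8) (h * h * h * h * - fromℕ 3) b
    expand₁ b = trans (cong (λ w → (b + - w) * (b + h) * (b + h) * (b + h)) a+N≡3h) (identity b h)
      where
      identity : ∀ b h → (b + - (h + h + h)) * (b + h) * (b + h) * (b + h) ≡
        b * b * b * b + h * h * - fromℕ 6 * b * b + h * h * h * - fromℕ 8 * b + h * h * h * h * - fromℕ 3
      identity = solve-∀ ring

    expand₂ : ∀ b → (b + x₁) * (b + h) * (b + 0ℚ) * (b + (h + h)) ≡
      quartic (h * h * - fromℕ 7) (h * h * h * - fromℕ 6) 0ℚ b
    expand₂ b = trans (cong (λ w → (b + - w) * (b + h) * (b + 0ℚ) * (b + (h + h))) a+N≡3h) (identity b h)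
      where
      identity : ∀ b h → (b + - (h + h + h)) * (b + h) * (b + 0ℚ) * (b + (h + h)) ≡
        b * b * b * b + h * h * - fromℕ 7 * b * b + h * h * h * - fromℕ 6 * b + 0ℚ
      identity = solve-∀ ring

    module Point₁ = FourShifts x₁ h h h
      (h * h * - fromℕ 6) (h * h * h * - fromℕ 8) (h * h * h * h * - fromℕ 3) expand₁
      (∣-scale h²∈ (integral-fromℤ -[1+ 5 ])) (∣-scale h³∈ (integral-fromℤ -[1+ 7 ])) (∣-scale h⁴∈ (integral-fromℤ -[1+ 2 ]))
      x₁∈ h-integral h-integral h-integral adm₀ unit-3h unit-h unit-h unit-h

    module Point₂ = FourShifts x₁ h 0ℚ (h + h)
      (h * h * - fromℕ 7) (h * h * h * - fromℕ 6) 0ℚ expand₂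
      (∣-scale h²∈ (integral-fromℤ -[1+ 6 ])) (∣-scale h³∈ (integral-fromℤ -[1+ 5 ])) ∣-0
      x₁∈ h-integral 0∈ (integral-+ h-integral h-integral) adm₀ unit-3h unit-h adm₀ unit-2h

    term term₁ term₂ error : ℕ → ℚ
    term k = (fromℕ k + fromℕ k + a) * fifth (c k)
    term₁ k = weight N k * (quotient a h k * quotient a h k * quotient a h k)
    term₂ k = weight N k * (quotient a h k * c k * quotient a (h + h) k)
    error k = term k - (fromℕ 7 * term₁ k + - fromℕ 6 * term₂ k) - fromℕ 20 * (h * h * h) * g k

    -- In 7(1 - 6h²A - 8h³B) - 6(1 - 7h²A - 6h³B) the constant is 1, the A terms cancel and -56 + 36
    -- leaves -20h³B. The scaling by (2k + a) `c k` turns the fourth powers into fifth powers and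
    -- completes the weights.
    error∈ : ∀ k → k ℕ.≤ N → p^ 4 ∣ error k
    error∈ k k≤N = subst (p^ 4 ∣_)
      (identity (fromℕ k) a (c k) (quotient a x₁ k) (quotient a h k) (quotient a (h + h) k) h (squares k) (cubes k))
      (∣-scale (∣-- (∣-scale (Point₂.quotient-expansion k k≤N) (integral-fromℤ (+ 6)))
                    (∣-scale (Point₁.quotient-expansion k k≤N) (integral-fromℤ (+ 7))))
        (integral-* (integral-+ (integral-+ (integral-fromℤ (+ k)) (integral-fromℤ (+ k))) a∈) (c∈ k k≤N)))
      where
      identity : ∀ k a c q r s h A B →
        ((q * r * c * s - c * c * c * c * (1ℚ + h * h * - fromℕ 7 * A + h * h * h * - fromℕ 6 * B)) * fromℕ 6
        - (q * r * r * r - c * c * c * c * (1ℚ + h * h * - fromℕ 6 * A + h * h * h * - fromℕ 8 * B)) * fromℕ 7)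
          * ((k + k + a) * c)
        ≡ (k + k + a) * (c * c * c * c * c)
          - (fromℕ 7 * ((k + k + a) * c * q * (r * r * r)) + - fromℕ 6 * ((k + k + a) * c * q * (r * c * s)))
          - fromℕ 20 * (h * h * h) * ((k + k + a) * (c * c * c * c * c * B))
      identity = solve-∀ ring

    sum-head : p^ 4 ∣ sumTo (suc N) term
    sum-head = subst (p^ 4 ∣_) (sym equation)
      (∣-+ (∣-sumTo (suc N) (λ k k<sN → error∈ k (ℕ.≤-pred k<sN)))
        (∣-* {3} {1} (subst (p^ 3 ∣_) (*-comm (h * h * h) (fromℕ 20)) (∣-scale h³∈ (integral-fromℤ (+ 20)))) sum-g))
      where
      open ≡-Reasoning
      K = fromℕ 20 * (h * h * h)
      Σ : (ℕ → ℚ) → ℚ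
      Σ = sumTo (suc N)
      -- The coefficients `1ℚ` give the decomposition the shape to which `sumTo-linear` applies.
      split : ∀ k → term k ≡ 1ℚ * (1ℚ * error k + K * g k) + 1ℚ * (fromℕ 7 * term₁ k + - fromℕ 6 * term₂ k)
      split k = identity (term k) (fromℕ 7 * term₁ k + - fromℕ 6 * term₂ k) (K * g k)
        where
        identity : ∀ x y z → x ≡ 1ℚ * (1ℚ * (x - y - z) + z) + 1ℚ * y
        identity = solve-∀ ring
      drop : ∀ E G → 1ℚ * (1ℚ * E + G) + 1ℚ * (fromℕ 7 * 0ℚ + - fromℕ 6 * 0ℚ) ≡ E + G
      drop = solve-∀ ring
      equation : Σ term ≡ Σ error + K * Σ g
      equation = begin
        Σ term
          ≡⟨ sumTo-cong (suc N) split ⟩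
        Σ (λ k → 1ℚ * (1ℚ * error k + K * g k) + 1ℚ * (fromℕ 7 * term₁ k + - fromℕ 6 * term₂ k))
          ≡⟨ sumTo-linear (suc N) 1ℚ 1ℚ (λ k → 1ℚ * error k + K * g k) (λ k → fromℕ 7 * term₁ k + - fromℕ 6 * term₂ k) ⟩
        1ℚ * Σ (λ k → 1ℚ * error k + K * g k) + 1ℚ * Σ (λ k → fromℕ 7 * term₁ k + - fromℕ 6 * term₂ k)
          ≡⟨ cong₂ (λ y z → 1ℚ * y + 1ℚ * z) (sumTo-linear (suc N) 1ℚ K error g) (sumTo-linear (suc N) (fromℕ 7) (- fromℕ 6) term₁ term₂) ⟩
        1ℚ * (1ℚ * Σ error + K * Σ g) + 1ℚ * (fromℕ 7 * Σ term₁ + - fromℕ 6 * Σ term₂)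
          ≡⟨ cong₂ (λ y z → 1ℚ * (1ℚ * Σ error + K * Σ g) + 1ℚ * (fromℕ 7 * y + - fromℕ 6 * z)) (zero-h-h-h N 3t<N) (zero-h-0-2h N 3t<N) ⟩
        1ℚ * (1ℚ * Σ error + K * Σ g) + 1ℚ * (fromℕ 7 * 0ℚ + - fromℕ 6 * 0ℚ)
          ≡⟨ drop (Σ error) (K * Σ g) ⟩
        Σ error + K * Σ g ∎

    -- The numerator factor at index N is a + N = 3h. The denominators up to p - 1 are prime to p,
    -- so the factor p acquired there persists.
    tail-divisible : ∀ e → e ℕ.+ suc N ℕ.< p → p^ 1 ∣ c (e ℕ.+ suc N)
    tail-divisible zero    sN<p = subst (p^ 1 ∣_) equation
      (∣-scale 3h∈ (integral-* (inv-integral (unit-0 N sN<p)) (c∈ N ℕ.≤-refl)))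
      where
      identity : ∀ q a n u → (a + n) * (u * q) ≡ q * ((a + 0ℚ + n) * u)
      identity = solve-∀ ring
      equation : (h + h + h) * (den⁻¹ N * c N) ≡ c (suc N)
      equation = trans (cong (_* (den⁻¹ N * c N)) (sym a+N≡3h)) (identity (c N) a (fromℕ N) (den⁻¹ N))
    tail-divisible (suc e) k<p = ∣-scale (tail-divisible e (ℕ.<-trans (ℕ.n<1+n _) k<p))
      (integral-* (integral-+ (integral-+ a∈ 0∈) (integral-fromℤ (+ (e ℕ.+ suc N)))) (inv-integral (unit-0 (e ℕ.+ suc N) k<p)))

    sum-extend : ∀ e → e ℕ.+ suc N ℕ.≤ p → p^ 4 ∣ sumTo (e ℕ.+ suc N) term
    sum-extend zero    _   = sum-head
    sum-extend (suc e) k<p = ∣-+ (sum-extend e (ℕ.<⇒≤ k<p))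
      (subst (p^ 4 ∣_) (*-comm (fifth (c k)) (fromℕ k + fromℕ k + a))
        -- Four copies of `c k` supply p⁴; the fifth enters as an integral factor.
        (∣-scale (∣-scale (∣-* (∣-* (∣-* c∈′ c∈′) c∈′) c∈′) (∣-integral c∈′))
          (integral-+ (integral-+ (integral-fromℤ (+ k)) (integral-fromℤ (+ k))) a∈)))
      where
      k = e ℕ.+ suc N
      c∈′ = tail-divisible e k<p

    sum-divisible : p^ 4 ∣ sumTo p term
    sum-divisible = subst (λ n → p^ 4 ∣ sumTo n term) (sym p≡) (sum-extend (t ℕ.+ t) (ℕ.≤-reflexive (sym p≡)))

-- Specialisation to a = r/5 and h = p/5

pochhammer-quotient : ∀ a k → pochhammer a k ≡ quotient a 0ℚ k * fromℕ (k !)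
pochhammer-quotient a zero    = refl
pochhammer-quotient a (suc k) = begin
  pochhammer a k * (a + x)
    ≡⟨ cong (_* (a + x)) (pochhammer-quotient a k) ⟩
  Q * f * (a + x)
    ≡⟨ *-identityʳ (Q * f * (a + x)) ⟨
  Q * f * (a + x) * 1ℚ
    ≡⟨ cong (Q * f * (a + x) *_) (*-inv (1-0+n≢0 k)) ⟨
  Q * f * (a + x) * ((1ℚ - 0ℚ + x) * u)
    ≡⟨ identity Q f a x u ⟩
  Q * ((a + 0ℚ + x) * u) * ((1ℚ + x) * f)
    ≡⟨ cong (Q * ((a + 0ℚ + x) * u) *_) (trans (fromℕ-* (suc k) (k !)) (cong (_* f) (fromℕ-suc k))) ⟨
  Q * ((a + 0ℚ + x) * u) * fromℕ (suc k !) ∎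
  where
  open ≡-Reasoning
  x = fromℕ k
  Q = quotient a 0ℚ k
  f = fromℕ (k !)
  u = inv (1ℚ - 0ℚ + x)
  identity : ∀ Q f a x u → Q * f * (a + x) * ((1ℚ - 0ℚ + x) * u) ≡ Q * ((a + 0ℚ + x) * u) * ((1ℚ + x) * f)
  identity = solve-∀ ring

summand-quotient : ∀ r k → let c = quotient (r / 5) 0ℚ k in
  summand r k ≡ fromℕ 5 * ((fromℕ k + fromℕ k + r / 5) * (c * c * c * c * c))
summand-quotient r k = begin
  fromℤ (+ 10 ℤ.* + k ℤ.+ r) * pochhammer a k ^ 5 * w
    ≡⟨ cong₂ (λ l P → l * P ^ 5 * w) lead (pochhammer-quotient a k) ⟩
  (fromℕ 10 * fromℕ k + a * fromℕ 5) * (c * f) ^ 5 * w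
    ≡⟨ identity (fromℕ k) a c f w ⟩
  fromℕ 5 * ((fromℕ k + fromℕ k + a) * (c * c * c * c * c)) * (w * (f * (f * (f * (f * (f * 1ℚ))))))
    ≡⟨ cong (X *_) (trans (cong (w *_) f^5) (i/n*n (+ 1) ((k !) ℕ.^ 5) {{k!^5≢0}})) ⟩
  X * 1ℚ
    ≡⟨ *-identityʳ X ⟩
  X ∎
  where
  open ≡-Reasoning
  a = r / 5
  c = quotient a 0ℚ k
  f = fromℕ (k !)
  k!^5≢0 : ℕ.NonZero ((k !) ℕ.^ 5)
  k!^5≢0 = ℕ.m^n≢0 (k !) 5 {{k ℕ.!≢0}}
  w = _/_ (+ 1) ((k !) ℕ.^ 5) {{k!^5≢0}}
  X = fromℕ 5 * ((fromℕ k + fromℕ k + a) * (c * c * c * c * c))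
  lead : fromℤ (+ 10 ℤ.* + k ℤ.+ r) ≡ fromℕ 10 * fromℕ k + a * fromℕ 5
  lead = trans (fromℤ-+ (+ 10 ℤ.* + k) r) (cong₂ _+_ (fromℤ-* (+ 10) (+ k)) (sym (i/n*n r 5)))
  step : ∀ m {x} → fromℕ m ≡ x → fromℕ (k ! ℕ.* m) ≡ f * x
  step m m≡x = trans (fromℕ-* (k !) m) (cong (f *_) m≡x)
  f^5 : f * (f * (f * (f * (f * 1ℚ)))) ≡ fromℕ ((k !) ℕ.^ 5)
  f^5 = sym (step ((k !) ℕ.^ 4) (step ((k !) ℕ.^ 3) (step ((k !) ℕ.^ 2) (step ((k !) ℕ.^ 1) (step 1 refl)))))
  identity : ∀ k a c f w →
    (fromℕ 10 * k + a * fromℕ 5) * (c * f * (c * f * (c * f * (c * f * (c * f * 1ℚ))))) * w ≡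
    fromℕ 5 * ((k + k + a) * (c * c * c * c * c)) * (w * (f * (f * (f * (f * (f * 1ℚ))))))
  identity = solve-∀ ring

module OddPrime (p : ℕ) (pr : Prime p) (r : ℤ) (t M : ℕ)
  (p≡ : p ≡ t ℕ.+ t ℕ.+ suc (M ℕ.+ M)) (3t<N : t ℕ.+ (t ℕ.+ t) ℕ.< M ℕ.+ M)
  (r≡ : r ≡ + 5 ℤ.* + suc (t ℕ.+ t) ℤ.- + 2 ℤ.* + p) (5∤p : ¬ (5 ℕ.∣ p)) where
  open Localisation p pr
  open Expansion p pr

  a h : ℚ
  a = r / 5
  h = + p / 5

  5a≡r : a * fromℕ 5 ≡ fromℤ r
  5a≡r = i/n*n r 5

  5h≡p : h * fromℕ 5 ≡ fromℕ p
  5h≡p = i/n*n (+ p) 5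

  p∤5 : ¬ (p ℕ.∣ 5)
  p∤5 p∣5 = [ (λ p≡1 → ℕ.nonTrivial⇒≢1 {{prime⇒nonTrivial pr}} p≡1) , (λ p≡5 → 5∤p (ℕ.∣-reflexive (sym p≡5))) ]′
    (from-yes (irreducible? 5) p∣5)

  affine : ∀ {x} i z → x ≡ fromℤ i + fromℤ z * h → x * fromℕ 5 ≡ fromℤ (i ℤ.* + 5 ℤ.+ z ℤ.* + p)
  affine {x} i z x≡ = begin
    x * fromℕ 5                                ≡⟨ cong (_* fromℕ 5) x≡ ⟩
    (fromℤ i + fromℤ z * h) * fromℕ 5          ≡⟨ identity (fromℤ i) (fromℤ z) h (fromℕ 5) ⟩
    fromℤ i * fromℕ 5 + fromℤ z * (h * fromℕ 5) ≡⟨ cong (λ y → fromℤ i * fromℕ 5 + fromℤ z * y) 5h≡p ⟩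
    fromℤ i * fromℕ 5 + fromℤ z * fromℕ p      ≡⟨ cong₂ _+_ (fromℤ-* i (+ 5)) (fromℤ-* z (+ p)) ⟨
    fromℤ (i ℤ.* + 5) + fromℤ (z ℤ.* + p)      ≡⟨ fromℤ-+ (i ℤ.* + 5) (z ℤ.* + p) ⟨
    fromℤ (i ℤ.* + 5 ℤ.+ z ℤ.* + p)            ∎
    where
    open ≡-Reasoning
    identity : ∀ i z h f → (i + z * h) * f ≡ i * f + z * (h * f)
    identity = solve-∀ ring

  -- 5x = 5i + zp is congruent to 5i modulo p, and p divides neither 5 nor i.
  affine-unit : ∀ {x} i z → 0 ℕ.< i → i ℕ.< p → x ≡ fromℕ i + fromℤ z * h → Unit x
  affine-unit {x} i z 0<i i<p x≡ = unit (unit-≢0 (+ 5) n p∤n 5x≡n) (integral-inv {x} (+ 5) n p∤n 5x≡n)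
    where
    n = + i ℤ.* + 5 ℤ.+ z ℤ.* + p
    5x≡n : x * fromℕ 5 ≡ fromℤ n
    5x≡n = affine (+ i) z x≡
    p∤n : ¬ (p ℕ.∣ ℤ.∣ n ∣)
    p∤n p∣n = [ (λ p∣i → ℕ.<⇒≱ i<p (ℕ.∣⇒≤ {{ℕ.>-nonZero 0<i}} p∣i)) , p∤5 ]′
      (euclidsLemma i 5 pr (subst (p ℕ.∣_) (ℤ.abs-* (+ i) (+ 5))
        (Signed.∣⇒∣ᵤ {+ p} {+ i ℤ.* + 5}
          (Signed.∣m+n∣n⇒∣m {+ p} {+ i ℤ.* + 5} {z ℤ.* + p} (Signed.∣ᵤ⇒∣ {+ p} {n} p∣n) (Signed.∣n⇒∣m*n z Signed.∣-refl)))))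

  -- If x were zero, then 5i + zp = 0 would make 5 divide zp, hence z or p.
  affine-≢0 : ∀ {x} i z → ¬ (5 ℕ.∣ ℤ.∣ z ∣) → x ≡ fromℤ i + fromℤ z * h → x ≢ 0ℚ
  affine-≢0 {x} i z 5∤z x≡ x≡0 = [ 5∤z , 5∤p ]′ (euclidsLemma ℤ.∣ z ∣ p (from-yes (prime? 5)) (subst (5 ℕ.∣_) (ℤ.abs-* z (+ p))
    (Signed.∣⇒∣ᵤ {+ 5} {z ℤ.* + p} (Signed.∣m+n∣m⇒∣n {+ 5} {i ℤ.* + 5} {z ℤ.* + p}
      (subst (Signed._∣_ (+ 5)) (sym n≡0) (Signed.divides (+ 0) refl)) (Signed.∣n⇒∣m*n i Signed.∣-refl)))))
    where
    n≡0 : i ℤ.* + 5 ℤ.+ z ℤ.* + p ≡ + 0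
    n≡0 = fromℤ-injective (trans (sym (affine i z x≡)) (trans (cong (_* fromℕ 5) x≡0) (*-zeroˡ (fromℕ 5))))

  h∉ℤ : ∀ i → fromℤ i - h ≢ 0ℚ
  h∉ℤ i = affine-≢0 i -[1+ 0 ] (from-no (5 ℕ.∣? 1)) (identity (fromℤ i) h)
    where
    identity : ∀ i h → i - h ≡ i + - 1ℚ * h
    identity = solve-∀ ring

  2h∉ℤ : ∀ i → fromℤ i - (h + h) ≢ 0ℚ
  2h∉ℤ i = affine-≢0 i -[1+ 1 ] (from-no (5 ℕ.∣? 2)) (identity (fromℤ i) h)
    where
    identity : ∀ i h → i - (h + h) ≡ i + - fromℕ 2 * h
    identity = solve-∀ ring

  m≡ : fromℕ (suc (t ℕ.+ t)) ≡ 1ℚ + (fromℕ t + fromℕ t)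
  m≡ = trans (fromℕ-suc (t ℕ.+ t)) (cong (_+_ 1ℚ) (fromℤ-+ (+ t) (+ t)))

  r≡ℚ : fromℤ r ≡ fromℕ 5 * (1ℚ + (fromℕ t + fromℕ t)) + - (fromℕ 2 * fromℕ p)
  r≡ℚ = begin
    fromℤ r
      ≡⟨ cong fromℤ r≡ ⟩
    fromℤ (+ 5 ℤ.* + suc (t ℕ.+ t) ℤ.- + 2 ℤ.* + p)
      ≡⟨ fromℤ-+ (+ 5 ℤ.* + suc (t ℕ.+ t)) (ℤ.- (+ 2 ℤ.* + p)) ⟩
    fromℤ (+ 5 ℤ.* + suc (t ℕ.+ t)) + fromℤ (ℤ.- (+ 2 ℤ.* + p))
      ≡⟨ cong₂ _+_ (trans (fromℤ-* (+ 5) (+ suc (t ℕ.+ t))) (cong (fromℕ 5 *_) m≡))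
           (trans (fromℤ-neg (+ 2 ℤ.* + p)) (cong -_ (fromℤ-* (+ 2) (+ p)))) ⟩
    fromℕ 5 * (1ℚ + (fromℕ t + fromℕ t)) + - (fromℕ 2 * fromℕ p) ∎
    where open ≡-Reasoning

  a≡ : a ≡ 1ℚ + (fromℕ t + fromℕ t) - (h + h)
  a≡ = *-cancelʳ-≢0 (fromℕ 5) (1+n≢0 4) (trans 5a≡r (trans r≡ℚ
    (trans (cong (λ P → fromℕ 5 * (1ℚ + (fromℕ t + fromℕ t)) + - (fromℕ 2 * P)) (sym 5h≡p)) (identity (fromℕ t) h))))
    where
    identity : ∀ t h → fromℕ 5 * (1ℚ + (t + t)) + - (fromℕ 2 * (h * fromℕ 5)) ≡ (1ℚ + (t + t) - (h + h)) * fromℕ 5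
    identity = solve-∀ ring

  a+N≡3h : a + fromℕ (M ℕ.+ M) ≡ h + h + h
  a+N≡3h = *-cancelʳ-≢0 (fromℕ 5) (1+n≢0 4) (begin
    (a + N) * fromℕ 5
      ≡⟨ cong (λ b → (b + N) * fromℕ 5) a≡ ⟩
    (1ℚ + (fromℕ t + fromℕ t) - (h + h) + N) * fromℕ 5
      ≡⟨ identity (fromℕ t) h N ⟩
    fromℕ 5 * (fromℕ t + fromℕ t + (1ℚ + N)) + - (h * fromℕ 5) + - (h * fromℕ 5)
      ≡⟨ cong (λ P → fromℕ 5 * P + - (h * fromℕ 5) + - (h * fromℕ 5)) p≡ℚ ⟨
    fromℕ 5 * fromℕ p + - (h * fromℕ 5) + - (h * fromℕ 5)
      ≡⟨ cong (λ P → fromℕ 5 * P + - (h * fromℕ 5) + - (h * fromℕ 5)) 5h≡p ⟨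
    fromℕ 5 * (h * fromℕ 5) + - (h * fromℕ 5) + - (h * fromℕ 5)
      ≡⟨ identity′ h ⟩
    (h + h + h) * fromℕ 5 ∎)
    where
    open ≡-Reasoning
    N = fromℕ (M ℕ.+ M)
    p≡ℚ : fromℕ p ≡ fromℕ t + fromℕ t + (1ℚ + N)
    p≡ℚ = trans (cong fromℕ p≡) (trans (fromℤ-+ (+ (t ℕ.+ t)) (+ suc (M ℕ.+ M))) (cong₂ _+_ (fromℤ-+ (+ t) (+ t)) (fromℕ-suc (M ℕ.+ M))))
    identity : ∀ t h N → (1ℚ + (t + t) - (h + h) + N) * fromℕ 5 ≡ fromℕ 5 * (t + t + (1ℚ + N)) + - (h * fromℕ 5) + - (h * fromℕ 5)
    identity = solve-∀ ring
    identity′ : ∀ h → fromℕ 5 * (h * fromℕ 5) + - (h * fromℕ 5) + - (h * fromℕ 5) ≡ (h + h + h) * fromℕ 5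
    identity′ = solve-∀ ring

  ⅕ : ℚ
  ⅕ = + 1 / 5

  h∈ : p^ 1 ∣ h
  h∈ = multiple ⅕ (integral 5 (+ 1) p∤5 (i/n*n (+ 1) 5)) (*-cancelʳ-≢0 (fromℕ 5) (1+n≢0 4) (begin
    h * fromℕ 5                        ≡⟨ 5h≡p ⟩
    fromℕ p                            ≡⟨ cong fromℕ (ℕ.*-identityʳ p) ⟨
    fromℕ (p ℕ.^ 1)                    ≡⟨ *-identityʳ (fromℕ (p ℕ.^ 1)) ⟨
    fromℕ (p ℕ.^ 1) * 1ℚ               ≡⟨ cong (fromℕ (p ℕ.^ 1) *_) (i/n*n (+ 1) 5) ⟨
    fromℕ (p ℕ.^ 1) * (⅕ * fromℕ 5)    ≡⟨ *-assoc (fromℕ (p ℕ.^ 1)) ⅕ (fromℕ 5) ⟨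
    fromℕ (p ℕ.^ 1) * ⅕ * fromℕ 5      ∎))
    where open ≡-Reasoning

  a∈ : Integral a
  a∈ = integral 5 r p∤5 5a≡r

  N<p : M ℕ.+ M ℕ.< p
  N<p = subst (M ℕ.+ M ℕ.<_) (sym p≡) (ℕ.m≤n+m (suc (M ℕ.+ M)) (t ℕ.+ t))

  -- a + j = (m + j) - 2h with m = 2t + 1, and m + j lies strictly between 0 and m + N = p.
  numerator-unit : ∀ j → j ℕ.< M ℕ.+ M → Unit (a + 0ℚ + fromℕ j)
  numerator-unit j j<N = affine-unit (suc (t ℕ.+ t) ℕ.+ j) -[1+ 1 ] (s≤s z≤n)
    (subst (suc (t ℕ.+ t) ℕ.+ j ℕ.<_) (sym (trans p≡ (ℕ.+-suc (t ℕ.+ t) (M ℕ.+ M)))) (s≤s (ℕ.+-monoʳ-< (t ℕ.+ t) j<N)))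
    (begin
      a + 0ℚ + fromℕ j
        ≡⟨ cong (λ b → b + 0ℚ + fromℕ j) a≡ ⟩
      1ℚ + (fromℕ t + fromℕ t) - (h + h) + 0ℚ + fromℕ j
        ≡⟨ identity (1ℚ + (fromℕ t + fromℕ t)) h (fromℕ j) ⟩
      1ℚ + (fromℕ t + fromℕ t) + fromℕ j + - fromℕ 2 * h
        ≡⟨ cong (λ b → b + fromℕ j + - fromℕ 2 * h) m≡ ⟨
      fromℕ (suc (t ℕ.+ t)) + fromℕ j + - fromℕ 2 * h
        ≡⟨ cong (_+ - fromℕ 2 * h) (fromℤ-+ (+ suc (t ℕ.+ t)) (+ j)) ⟨
      fromℕ (suc (t ℕ.+ t) ℕ.+ j) + - fromℕ 2 * h ∎)
    where
    open ≡-Reasoning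
    identity : ∀ m h j → m - (h + h) + 0ℚ + j ≡ m + j + - fromℕ 2 * h
    identity = solve-∀ ring

  denominator-unit : ∀ x z → - x ≡ fromℤ z * h → ∀ j → suc j ℕ.< p → Unit (1ℚ - x + fromℕ j)
  denominator-unit x z -x≡ j j<p = affine-unit (suc j) z (s≤s z≤n) j<p
    (trans (identity x (fromℕ j)) (cong₂ _+_ (sym (fromℕ-suc j)) -x≡))
    where
    identity : ∀ x j → 1ℚ - x + j ≡ 1ℚ + j + - x
    identity = solve-∀ ring

  private
    below : ∀ {j} → j ℕ.< M ℕ.+ M → suc j ℕ.< p
    below j<N = ℕ.≤-<-trans j<N N<p

  unit-0 : ∀ j → suc j ℕ.< p → Unit (1ℚ - 0ℚ + fromℕ j)
  unit-0 = denominator-unit 0ℚ (+ 0) (identity h)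
    where
    identity : ∀ h → - 0ℚ ≡ 0ℚ * h
    identity = solve-∀ ring

  unit-h : ∀ j → j ℕ.< M ℕ.+ M → Unit (1ℚ - h + fromℕ j)
  unit-h j j<N = denominator-unit h -[1+ 0 ] (identity h) j (below j<N)
    where
    identity : ∀ h → - h ≡ - 1ℚ * h
    identity = solve-∀ ring

  unit-2h : ∀ j → j ℕ.< M ℕ.+ M → Unit (1ℚ - (h + h) + fromℕ j)
  unit-2h j j<N = denominator-unit (h + h) -[1+ 1 ] (identity h) j (below j<N)
    where
    identity : ∀ h → - (h + h) ≡ - fromℕ 2 * h
    identity = solve-∀ ring

  unit-3h : ∀ j → j ℕ.< M ℕ.+ M → Unit (1ℚ - - (a + fromℕ (M ℕ.+ M)) + fromℕ j)
  unit-3h j j<N = denominator-unit (- (a + fromℕ (M ℕ.+ M))) (+ 3)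
    (trans (cong (λ s → - - s) a+N≡3h) (identity h)) j (below j<N)
    where
    identity : ∀ h → - - (h + h + h) ≡ fromℕ 3 * h
    identity = solve-∀ ring

  open Congruence p pr a h t M p≡ 3t<N a≡ a+N≡3h h∉ℤ 2h∉ℤ

  congruence : ∑[ k < p ] summand r (toℕ k) ≡ 0ℚ [mod p ^ 4 ]
  congruence = q , integral⇒coprime q∈ , (begin
    ∑[ k < p ] summand r (toℕ k) - 0ℚ  ≡⟨ cong (_- 0ℚ) (sum-toℕ p (summand r)) ⟩
    sumTo p (summand r) - 0ℚ           ≡⟨ +-identityʳ (sumTo p (summand r)) ⟩
    sumTo p (summand r)                ≡⟨ sumTo-cong p (λ k → trans (summand-quotient r k) (*-comm (fromℕ 5) (F k))) ⟩
    sumTo p (λ k → F k * fromℕ 5)      ≡⟨ sumTo-scale p (fromℕ 5) F ⟩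
    sumTo p F * fromℕ 5                ≡⟨ q≡ ⟩
    fromℕ (p ℕ.^ 4) * q                ∎)
    where
    open ≡-Reasoning
    F : ℕ → ℚ
    F k = let c = quotient a 0ℚ k in (fromℕ k + fromℕ k + a) * (c * c * c * c * c)
    open p^_∣_ (∣-scale (sum-divisible h∈ a∈ numerator-unit unit-0 unit-h unit-2h unit-3h) (integral-fromℤ (+ 5)))
      renaming (cofactor to q; cofactor-integral to q∈; factored to q≡)

-- The prime 2 and the reduction to odd primes

congruence-2 : ∑[ k < 2 ] summand 1ℤ (toℕ k) ≡ 0ℚ [mod 2 ^ 4 ]
-- The sum is 1 + 11/5⁵ = 3136/3125, and 3136 = 16 · 196.
congruence-2 = + 196 / 3125 , from-yes (ℕ.coprime? 3125 2) , refl

parity : ∀ n → ∃[ k ] (n ≡ k ℕ.+ k ⊎ n ≡ suc (k ℕ.+ k))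
parity zero = 0 , inj₁ refl
parity (suc n) = case (parity n)
  where
  case : ∃[ k ] (n ≡ k ℕ.+ k ⊎ n ≡ suc (k ℕ.+ k)) → ∃[ k ] (suc n ≡ k ℕ.+ k ⊎ suc n ≡ suc (k ℕ.+ k))
  case (k , inj₁ n≡) = k , inj₂ (cong suc n≡)
  case (k , inj₂ n≡) = suc k , inj₁ (cong suc (trans n≡ (sym (ℕ.+-suc k k))))

5≤2p+r : ∀ r p → fromℕ p ≥ (+ 5 ℤ.- r) / 2 → + 5 ℤ.≤ + 2 ℤ.* + p ℤ.+ r
5≤2p+r r p p≥ = subst₂ ℤ._≤_ (left r) (right r (+ p)) (ℤ.+-monoˡ-≤ r (cross
  (ℚᵘ.≤-trans (ℚᵘ.≤-reflexive (ℚᵘ.≃-sym (toℚᵘ-fromℚᵘ (ℚᵘ.mkℚᵘ (+ 5 ℤ.- r) 1))))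
    (ℚᵘ.≤-trans (toℚᵘ-mono-≤ p≥) (ℚᵘ.≤-reflexive (toℚᵘ-fromℤ (+ p)))))))
  where
  cross : ℚᵘ.mkℚᵘ (+ 5 ℤ.- r) 1 ℚᵘ.≤ ℚᵘ.mkℚᵘ (+ p) 0 → (+ 5 ℤ.- r) ℤ.* + 1 ℤ.≤ + p ℤ.* + 2
  cross (ℚᵘ.*≤* le) = le
  left : ∀ r → (+ 5 ℤ.- r) ℤ.* + 1 ℤ.+ r ≡ + 5
  left = ℤ-Solver.solve-∀
  right : ∀ r p → p ℤ.* + 2 ℤ.+ r ≡ + 2 ℤ.* p ℤ.+ r
  right = ℤ-Solver.solve-∀

theorem1 : ∀ (r : ℤ) → r ℤ.≤ 1ℤ → ¬ (+ 2 ∣ r) → Coprime r (+ 5) →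
    ∀ (p : ℕ) → Prime p →
    + 5 ∣ (+ 2 ℤ.* + p) ℤ.- (ℤ.- r) →
    fromℕ p ≥ (+ 5 ℤ.- r) / 2 →
    ∑[ k < p ] summand r (toℕ k) ≡ 0ℚ [mod p ^ 4 ]
theorem1 r r≤1 2∤r r⊥5 p pr 5∣ p≥ = by-m (Signed.∣ᵤ⇒∣ {+ 5} {+ 2 ℤ.* + p ℤ.- (ℤ.- r)} 5∣)
  where
  isolate : ∀ p r → r ≡ (+ 2 ℤ.* p ℤ.- (ℤ.- r)) ℤ.- + 2 ℤ.* p
  isolate = ℤ-Solver.solve-∀

  5∤p : ¬ (5 ℕ.∣ p)
  5∤p 5∣p = absurd (r⊥5 {5} (Signed.∣⇒∣ᵤ {+ 5} {r} 5∣r , ℕ.∣-refl))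
    where
    absurd : 5 ≢ 1
    absurd ()
    5∣r : + 5 Signed.∣ r
    5∣r = subst (Signed._∣_ (+ 5)) (sym (isolate (+ p) r)) (Signed.∣m∣n⇒∣m-n (Signed.∣ᵤ⇒∣ {+ 5} {+ 2 ℤ.* + p ℤ.- (ℤ.- r)} 5∣)
      (Signed.∣n⇒∣m*n (+ 2) (Signed.∣ᵤ⇒∣ {+ 5} {+ p} 5∣p)))

  Goal : Set
  Goal = ∑[ k < p ] summand r (toℕ k) ≡ 0ℚ [mod p ^ 4 ]

  by-parity : ∀ m → 0 ℕ.< m → r ≡ + 5 ℤ.* + m ℤ.- + 2 ℤ.* + p → m ℕ.* 5 ℕ.≤ p ℕ.* 2 ℕ.+ 1 → Goal
  by-parity m 0<m r≡ 5m≤ = case (parity m) (parity p)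
    where
    case : ∃[ t ] (m ≡ t ℕ.+ t ⊎ m ≡ suc (t ℕ.+ t)) → ∃[ q ] (p ≡ q ℕ.+ q ⊎ p ≡ suc (q ℕ.+ q)) → Goal
    -- An even m would make r = 5m - 2p even.
    case (t , inj₁ m≡) _ = contradiction (Signed.∣⇒∣ᵤ {+ 2} {r} (Signed.divides (+ 5 ℤ.* + t ℤ.- + p)
      (trans r≡ (trans (cong (λ m → + 5 ℤ.* + m ℤ.- + 2 ℤ.* + p) m≡) (double (+ t) (+ p)))))) 2∤r
      where
      double : ∀ t p → + 5 ℤ.* (t ℤ.+ t) ℤ.- + 2 ℤ.* p ≡ (+ 5 ℤ.* t ℤ.- p) ℤ.* + 2
      double = ℤ-Solver.solve-∀
    case (t , inj₂ m≡) (q , inj₁ p≡) = subst₂ (λ r p → ∑[ k < p ] summand r (toℕ k) ≡ 0ℚ [mod p ^ 4 ])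
      (sym r≡1) 2≡p congruence-2
      where
      double : ∀ q → q ℕ.+ q ≡ q ℕ.* 2
      double = ℕ-Solver.solve-∀
      2≢1 : 2 ≢ 1
      2≢1 ()
      2≡p : 2 ≡ p
      2≡p = [ (λ 2≡1 → contradiction 2≡1 2≢1) , (λ eq → eq) ]′ (prime⇒irreducible pr (ℕ.divides q (trans p≡ (double q))))
      m≡1 : m ≡ 1
      -- For p = 2 the bound reads 5m ≤ 5.
      m≡1 = ℕ.≤-antisym (ℕ.*-cancelʳ-≤ m 1 5 (subst (λ p → m ℕ.* 5 ℕ.≤ p ℕ.* 2 ℕ.+ 1) (sym 2≡p) 5m≤)) 0<m
      r≡1 : r ≡ 1ℤ
      r≡1 = trans r≡ (cong₂ (λ m p → + 5 ℤ.* + m ℤ.- + 2 ℤ.* + p) m≡1 (sym 2≡p))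
    case (t , inj₂ m≡) (q , inj₂ p≡) = OddPrime.congruence p pr r t M p≡′ 3t<N (trans r≡ (cong (λ m → + 5 ℤ.* + m ℤ.- + 2 ℤ.* + p) m≡)) 5∤p
      where
      -- Here p = 2q + 1 and m = 2t + 1, so N = p - m = 2(q - t) is even and has a middle index.
      M = q ℕ.∸ t
      -- 5m ≤ 2p + 1, which is r ≤ 1, becomes 10t + 2 ≤ 4q; subtracting 4t and halving gives 3t + 1
      -- ≤ N, the degree condition for the exact zeros.
      bound : 10 ℕ.* t ℕ.+ 2 ℕ.≤ 4 ℕ.* q
      bound = ℕ.+-cancelʳ-≤ 3 _ _ (subst₂ ℕ._≤_ (left t) (right q)
        (subst₂ (λ m p → m ℕ.* 5 ℕ.≤ p ℕ.* 2 ℕ.+ 1) m≡ p≡ 5m≤))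
        where
        left : ∀ t → suc (t ℕ.+ t) ℕ.* 5 ≡ 10 ℕ.* t ℕ.+ 2 ℕ.+ 3
        left = ℕ-Solver.solve-∀
        right : ∀ q → suc (q ℕ.+ q) ℕ.* 2 ℕ.+ 1 ≡ 4 ℕ.* q ℕ.+ 3
        right = ℕ-Solver.solve-∀
      t≤q : t ℕ.≤ q
      t≤q = ℕ.*-cancelˡ-≤ 4 (ℕ.≤-trans (ℕ.≤-trans (ℕ.m≤m+n (4 ℕ.* t) (6 ℕ.* t ℕ.+ 2)) (ℕ.≤-reflexive (split t))) bound)
        where
        split : ∀ t → 4 ℕ.* t ℕ.+ (6 ℕ.* t ℕ.+ 2) ≡ 10 ℕ.* t ℕ.+ 2
        split = ℕ-Solver.solve-∀
      q≡ : q ≡ t ℕ.+ M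
      q≡ = sym (ℕ.m+[n∸m]≡n t≤q)
      p≡′ : p ≡ t ℕ.+ t ℕ.+ suc (M ℕ.+ M)
      p≡′ = trans p≡ (trans (cong (λ q → suc (q ℕ.+ q)) q≡) (regroup t M))
        where
        regroup : ∀ t M → suc (t ℕ.+ M ℕ.+ (t ℕ.+ M)) ≡ t ℕ.+ t ℕ.+ suc (M ℕ.+ M)
        regroup = ℕ-Solver.solve-∀
      3t<N : t ℕ.+ (t ℕ.+ t) ℕ.< M ℕ.+ M
      3t<N = ℕ.*-cancelˡ-≤ 2 (ℕ.+-cancelʳ-≤ (4 ℕ.* t) _ _ (subst₂ ℕ._≤_ (left t) (right t M)
        (subst (λ q → 10 ℕ.* t ℕ.+ 2 ℕ.≤ 4 ℕ.* q) q≡ bound)))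
        where
        left : ∀ t → 10 ℕ.* t ℕ.+ 2 ≡ 2 ℕ.* suc (t ℕ.+ (t ℕ.+ t)) ℕ.+ 4 ℕ.* t
        left = ℕ-Solver.solve-∀
        right : ∀ t M → 4 ℕ.* (t ℕ.+ M) ≡ 2 ℕ.* (M ℕ.+ M) ℕ.+ 4 ℕ.* t
        right = ℕ-Solver.solve-∀

  by-m : + 5 Signed.∣ + 2 ℤ.* + p ℤ.- (ℤ.- r) → Goal
  by-m (Signed.divides μ s≡) = by-sign μ refl 0<μ
    where
    r≡ : r ≡ + 5 ℤ.* μ ℤ.- + 2 ℤ.* + p
    r≡ = trans (isolate (+ p) r) (cong (ℤ._- + 2 ℤ.* + p) (trans s≡ (ℤ.*-comm μ (+ 5))))
    2p+r≡ : + 2 ℤ.* + p ℤ.+ r ≡ μ ℤ.* + 5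
    2p+r≡ = trans (cong (ℤ._+_ (+ 2 ℤ.* + p)) (sym (ℤ.neg-involutive r))) s≡
    -- The lower bound on p amounts to 5 ≤ 2p + r = 5μ, so μ is the positive integer m.
    0<μ : + 1 ℤ.≤ μ
    0<μ = ℤ.*-cancelʳ-≤-pos (+ 1) μ (+ 5) (subst (ℤ._≤_ (+ 5)) 2p+r≡ (5≤2p+r r p p≥))
    5μ≤ : μ ℤ.* + 5 ℤ.≤ + 2 ℤ.* + p ℤ.+ 1ℤ
    5μ≤ = subst (ℤ._≤ + 2 ℤ.* + p ℤ.+ 1ℤ) 2p+r≡ (ℤ.+-monoʳ-≤ (+ 2 ℤ.* + p) r≤1)
    by-sign : ∀ ν → μ ≡ ν → + 1 ℤ.≤ ν → Goal
    by-sign (+ m) μ≡ (ℤ.+≤+ 0<m) = by-parity m 0<m (trans r≡ (cong (λ ν → + 5 ℤ.* ν ℤ.- + 2 ℤ.* + p) μ≡))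
      (ℤ.drop‿+≤+ (subst₂ ℤ._≤_ (trans (cong (ℤ._* + 5) μ≡) (sym (ℤ.pos-* m 5)))
        (cong (ℤ._+ 1ℤ) (trans (ℤ.*-comm (+ 2) (+ p)) (sym (ℤ.pos-* p 2)))) 5μ≤))
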